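{- Let $R$ be a Dedekind domain and let $I$ be a nonzero ideal of $R$ such that $R/I$ is finite and nontrivial. If $I$ has a prime ideal divisor $P$ with $|R/P|$ a power of $2$, then $\chi'(G_{R/I})=\varphi(R/I)$. Otherwise, $\chi'(G_{R/I})=\varphi(R/I)+1$.
   Context: $G_{R/I}$ is the unitary Cayley graph of $R/I$: vertex set $R/I$, with $a+I$, $b+I$ adjacent iff $a-b+I$ is a unit of $R/I$. $\varphi(R/I)=|U(R/I)|$ is the number of units of $R/I$. $\chi'$ denotes chromatic index. -}

module Defs where

open import Level using (Level; _⊔_; suc)
open import Algebra.Bundles using (CommutativeRing)
open import Data.Nat as ℕ using (ℕ; zero; _∸_; _≤_; _^_)
open import Data.Fin using (Fin)
open import Data.List using (List; []; _∷_; length)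
open import Data.List.Relation.Unary.All using (All)
open import Data.List.Relation.Unary.Any using (Any)
open import Data.Product using (Σ; Σ-syntax; ∃; _×_; _,_; proj₁; proj₂)
open import Data.Sum using (_⊎_)
open import Relation.Nullary using (¬_)
open import Relation.Binary.PropositionalEquality using (_≡_; _≢_)

module _ {c ℓ : Level} (R : CommutativeRing c ℓ) where
  open CommutativeRing R

  pow : Carrier → ℕ → Carrier
  pow x zero = 1#
  pow x (ℕ.suc k) = x * pow x k

  record Ideal : Set (suc (c ⊔ ℓ)) where
    field
      _∈I : Carrier → Set (c ⊔ ℓ)
      resp : ∀ {x y} → x ≈ y → x ∈I → y ∈I
      zero∈ : 0# ∈I
      +-closed : ∀ {x y} → x ∈I → y ∈I → (x + y) ∈I
      *-closed : ∀ r {x} → x ∈I → (r * x) ∈I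
  open Ideal public

  _∈_ : Carrier → Ideal → Set (c ⊔ ℓ)
  x ∈ J = Ideal._∈I J x

  _⊆_ : Ideal → Ideal → Set (c ⊔ ℓ)
  J ⊆ K = ∀ x → x ∈ J → x ∈ K

  NonzeroIdeal : Ideal → Set (c ⊔ ℓ)
  NonzeroIdeal J = Σ Carrier λ x → x ∈ J × ¬ (x ≈ 0#)

  IsProper : Ideal → Set (c ⊔ ℓ)
  IsProper J = ¬ (1# ∈ J)

  IsPrime : Ideal → Set (c ⊔ ℓ)
  IsPrime P = IsProper P × (∀ a b → (a * b) ∈ P → a ∈ P ⊎ b ∈ P)

  IsMaximal : Ideal → Set (suc (c ⊔ ℓ))
  IsMaximal P = IsProper P × (∀ (J : Ideal) → P ⊆ J → J ⊆ P ⊎ 1# ∈ J)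

  sumProd : List (Carrier × Carrier) → Carrier
  sumProd [] = 0#
  sumProd ((p , q) ∷ ps) = p * q + sumProd ps

  InSpan : List Carrier → Carrier → Set (c ⊔ ℓ)
  InSpan gs x = Σ (List (Carrier × Carrier)) λ ps →
    All (λ pr → Any (λ g → proj₂ pr ≈ g) gs) ps × x ≈ sumProd ps

  IsFinitelyGenerated : Ideal → Set (c ⊔ ℓ)
  IsFinitelyGenerated J = Σ (List Carrier) λ gs →
    ∀ x → (x ∈ J → InSpan gs x) × (InSpan gs x → x ∈ J)

  InProduct : Ideal → Ideal → Carrier → Set (c ⊔ ℓ)
  InProduct P J x = Σ (List (Carrier × Carrier)) λ ps →
    All (λ pr → proj₁ pr ∈ P × proj₂ pr ∈ J) ps × x ≈ sumProd ps

  _∣ᴵ_ : Ideal → Ideal → Set (suc (c ⊔ ℓ))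
  P ∣ᴵ I = Σ Ideal λ J → ∀ x → (x ∈ I → InProduct P J x) × (InProduct P J x → x ∈ I)

  IsIntegralDomain : Set (c ⊔ ℓ)
  IsIntegralDomain = ¬ (1# ≈ 0#) × (∀ a b → a * b ≈ 0# → a ≈ 0# ⊎ b ≈ 0#)

  -- b^n · f(a/b) for the monic f(X) = X^n + Σ_{i<n} cᵢ X^i, n = length cs
  homMonic : Carrier → Carrier → List Carrier → Carrier
  homMonic a b cs = pow a n + go 0 cs
    where
      n = length cs
      go : ℕ → List Carrier → Carrier
      go i [] = 0#
      go i (d ∷ ds) = d * pow a i * pow b (n ∸ i) + go (ℕ.suc i) ds

  -- integrally closed in its fraction field: if a/b (b ≠ 0) is a root of a
  -- monic polynomial over R, then a/b ∈ R, i.e. b divides a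
  IsIntegrallyClosed : Set (c ⊔ ℓ)
  IsIntegrallyClosed = ∀ a b (cs : List Carrier) → ¬ (b ≈ 0#) →
    homMonic a b cs ≈ 0# → Σ Carrier λ r → a ≈ r * b

  IsNoetherian : Set (suc (c ⊔ ℓ))
  IsNoetherian = ∀ (J : Ideal) → IsFinitelyGenerated J

  DimAtMostOne : Set (suc (c ⊔ ℓ))
  DimAtMostOne = ∀ (P : Ideal) → IsPrime P → NonzeroIdeal P → IsMaximal P

  IsDedekindDomain : Set (suc (c ⊔ ℓ))
  IsDedekindDomain = IsIntegralDomain × IsNoetherian × IsIntegrallyClosed × DimAtMostOne

  _≡[_]_ : Carrier → Ideal → Carrier → Set (c ⊔ ℓ)
  x ≡[ J ] y = (x - y) ∈ J

  CountMod : Ideal → (Carrier → Set (c ⊔ ℓ)) → ℕ → Set (c ⊔ ℓ)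
  CountMod J Q m = Σ (Fin m → Carrier) λ u →
    (∀ i → Q (u i)) ×
    (∀ i j → u i ≡[ J ] u j → i ≡ j) ×
    (∀ x → Q x → Σ (Fin m) λ i → x ≡[ J ] u i)

  QuotientCard : Ideal → ℕ → Set (c ⊔ ℓ)
  QuotientCard J m = CountMod J (λ _ → Lift⊤) m
    where
      open import Data.Unit.Polymorphic using (⊤)
      Lift⊤ : Set (c ⊔ ℓ)
      Lift⊤ = ⊤

  IsUnitMod : Ideal → Carrier → Set (c ⊔ ℓ)
  IsUnitMod J x = Σ Carrier λ y → (x * y) ≡[ J ] 1#

  UnitCount : Ideal → ℕ → Set (c ⊔ ℓ)
  UnitCount J m = CountMod J (IsUnitMod J) m

  Adj : Ideal → Carrier → Carrier → Set (c ⊔ ℓ)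
  Adj J a b = IsUnitMod J (a - b)

  -- proper edge colouring of G_{R/J} with k colours: a colour for each edge
  -- {a+J, b+J}, independent of representatives and orientation, with
  -- distinct colours on distinct edges at a common vertex
  EdgeColourable : Ideal → ℕ → Set (c ⊔ ℓ)
  EdgeColourable J k = Σ ((a b : Carrier) → Adj J a b → Fin k) λ col →
    (∀ a a' b b' p p' → a ≡[ J ] a' → b ≡[ J ] b' → col a b p ≡ col a' b' p') ×
    (∀ a b p q → col a b p ≡ col b a q) ×
    (∀ a b b' p p' → ¬ (b ≡[ J ] b') → col a b p ≢ col a b' p')

  ChromaticIndex : Ideal → ℕ → Set (c ⊔ ℓ)
  ChromaticIndex J k = EdgeColourable J k × (∀ m → EdgeColourable J m → k ≤ m)

  HasPow2PrimeDivisor : Ideal → Set (suc (c ⊔ ℓ))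
  HasPow2PrimeDivisor I = Σ Ideal λ P → IsPrime P × P ∣ᴵ I ×
    Σ ℕ λ e → QuotientCard P (2 ^ e)

{-# OPTIONS --safe #-}
-- Noetherianity, read constructively, decides every proposition: a generating
-- list of the ideal {x | x = 0 or A} tells whether A holds. So the argument may be
-- classical.
--
-- If P ∣ I has |R/P| = 2^e then 2 ∈ P, and R/I has an additive subgroup H of index
-- two that contains P/I and misses 1. For a unit s the coset of sH containing the
-- end of an edge alternates along the cycles a, a + s, a + 2s, …, so these cycles
-- are even and their edges can be coloured alternately by s and - s.
--
-- Otherwise 2 is a unit of R/I: if not, I + (2) lies in a maximal ideal P, whose
-- residue ring is a finite vector space over the field of two elements, and P ∣ I
-- because nonzero primes of a Dedekind domain are invertible. Negation then fixes only
-- 0, so |R/I| is odd, there is no perfect matching, and φ colours cannot suffice;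
-- φ + 1 colours do by Vizing's theorem.
module Submission where

open import Defs
open import Level using (Level; _⊔_; Lift; lift; lower)
open import Algebra.Bundles using (CommutativeRing)
open import Algebra.Solver.Ring.AlmostCommutativeRing using (fromCommutativeRing; _-Raw-AlmostCommutative⟶_)
import Algebra.Solver.Ring
import Algebra.Properties.AbelianGroup
import Algebra.Properties.CommutativeMonoid.Sum
import Algebra.Properties.Group
import Algebra.Properties.Ring
import Algebra.Properties.Semiring.Mult
import Algebra.Properties.Semiring.Mult.TCOptimised
open import Data.Empty using (⊥; ⊥-elim)
open import Data.Fin as Fin using (Fin; zero; suc; toℕ; splitAt; _↑ˡ_; _↑ʳ_)
open import Data.Fin.Permutation using (permutation)
import Data.Fin.Properties as Fin
open import Data.Integer as ℤ using (ℤ; +_; -[1+_]; ∣_∣; sign; _⊖_; _◃_)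
import Data.Integer.Properties as ℤ
open import Data.List using (List; []; _∷_; _∷ʳ_; allFin; cartesianProduct; foldr; length; tabulate)
open import Data.List.Membership.Propositional using () renaming (_∈_ to _∈ˡ_)
open import Data.List.Membership.Propositional.Properties using (∈-allFin; ∈-cartesianProduct⁺)
open import Data.List.Properties using (length-++)
open import Data.List.Relation.Unary.All as All using (All; []; _∷_)
import Data.List.Relation.Unary.All.Properties as All
open import Data.List.Relation.Unary.Any as Any using (Any; here; there)
open import Data.Maybe using (just; nothing)
open import Data.Nat as ℕ using (ℕ; zero; suc; _∸_; _^_; _≤_; _<_; z≤n; s≤s; z<s; s<s)
import Data.Nat.Properties as ℕ
open import Data.Nat.GeneralisedArithmetic using (fold; fold-+)
open import Data.Nat.Tactic.RingSolver using (solve-∀)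
open import Data.Product using (Σ; Σ-syntax; ∃; _×_; _,_; proj₁; proj₂)
open import Data.Sign as Sign using (Sign)
open import Data.Sum using (_⊎_; inj₁; inj₂; [_,_]′)
open import Function using (_∘_)
open import Relation.Binary.Definitions using (WeaklyDecidable; tri<; tri≈; tri>)
open import Relation.Binary.PropositionalEquality as ≡ using (_≡_; _≢_; ≢-sym)
open import Relation.Nullary using (¬_; Dec; yes; no)
open import Relation.Nullary.Decidable as Dec using (decidable-stable)

-- The subgroup `H` can only be additive: R/P is a field, so apart from R no ideal lies strictly
-- above P. As `H` need not be stable under multiplication, each unit s needs its own translate sH,
-- and the test whether a lies in (a - b)H becomes a test on t a with t inverse to a - b.
--
-- The graph is φ-regular, so with φ colours every colour occurs at every vertex; this turns a
-- colour class into a perfect matching.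
--
-- No fraction field is built. Invertibility of P starts from a nonzero a in I and some b with (a :
-- b) = P. If b/a carried P into P it would be integral, hence in R, and (a : b) would contain 1. So
-- b/a carries some p in P to an r outside P. Every statement about b/a is an equation cleared of
-- denominators.
--
-- Vizing's theorem is proved without constructing paths. A colour is an involution on the vertices,
-- and the fact that an alternating path has only one end besides its start becomes a statement
-- about orbits of two involutions.

-- Over an abstract ring 1# - 1# ≈ 0# is not decidable, so cancellation in the
-- ring solver needs integer coefficients.
module IntegerSolver {c ℓ : Level} (R : CommutativeRing c ℓ) where
  open CommutativeRing R hiding (zero)
  open Algebra.Properties.Ring ring using (-‿distribˡ-*; -‿distribʳ-*)
  open Algebra.Properties.Group +-group using (⁻¹-involutive; ε⁻¹≈ε)
  open Algebra.Properties.AbelianGroup +-abelianGroup using (⁻¹-∙-comm)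
  open Algebra.Properties.Semiring.Mult.TCOptimised semiring using (×-homo-+; ×1-homo-*; 1+×) renaming (_×_ to _·_)
  open import Relation.Binary.Reasoning.Setoid setoid

  fromℤ : ℤ → Carrier
  fromℤ (+ n) = n · 1#
  fromℤ -[1+ n ] = - (suc n · 1#)

  -- Integer multiplication is defined by sign and absolute value, so multiplicativity of `fromℤ` is
  -- proved in that form.
  signed : Sign → Carrier → Carrier
  signed Sign.+ x = x
  signed Sign.- x = - x

  signed-cong : ∀ s {x y} → x ≈ y → signed s x ≈ signed s y
  signed-cong Sign.+ e = e
  signed-cong Sign.- e = -‿cong e

  signed-* : ∀ s t x y → signed (s Sign.* t) (x * y) ≈ signed s x * signed t y
  signed-* Sign.+ Sign.+ x y = refl
  signed-* Sign.+ Sign.- x y = -‿distribʳ-* x y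
  signed-* Sign.- Sign.+ x y = -‿distribˡ-* x y
  signed-* Sign.- Sign.- x y = begin
    x * y         ≈⟨ ⁻¹-involutive _ ⟨
    - (- (x * y)) ≈⟨ -‿cong (-‿distribˡ-* x y) ⟩
    - (- x * y)   ≈⟨ -‿distribʳ-* (- x) y ⟩
    - x * - y     ∎

  fromℤ-◃ : ∀ s n → fromℤ (s ◃ n) ≈ signed s (n · 1#)
  fromℤ-◃ Sign.+ zero = refl
  fromℤ-◃ Sign.- zero = sym ε⁻¹≈ε
  fromℤ-◃ Sign.+ (suc n) = refl
  fromℤ-◃ Sign.- (suc n) = refl

  fromℤ-signed : ∀ i → fromℤ i ≈ signed (sign i) (∣ i ∣ · 1#)
  fromℤ-signed (+ n) = refl
  fromℤ-signed -[1+ n ] = refl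

  fromℤ-* : ∀ i j → fromℤ (i ℤ.* j) ≈ fromℤ i * fromℤ j
  fromℤ-* i j = begin
    fromℤ (i ℤ.* j)
      ≈⟨ fromℤ-◃ (sign i Sign.* sign j) (∣ i ∣ ℕ.* ∣ j ∣) ⟩
    signed (sign i Sign.* sign j) ((∣ i ∣ ℕ.* ∣ j ∣) · 1#)
      ≈⟨ signed-cong (sign i Sign.* sign j) (×1-homo-* ∣ i ∣ ∣ j ∣) ⟩
    signed (sign i Sign.* sign j) ((∣ i ∣ · 1#) * (∣ j ∣ · 1#))
      ≈⟨ signed-* (sign i) (sign j) _ _ ⟩
    signed (sign i) (∣ i ∣ · 1#) * signed (sign j) (∣ j ∣ · 1#)
      ≈⟨ *-cong (fromℤ-signed i) (fromℤ-signed j) ⟨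
    fromℤ i * fromℤ j ∎

  cancel-1+ : ∀ x y → (1# + x) - (1# + y) ≈ x - y
  cancel-1+ x y = begin
    (1# + x) - (1# + y)       ≈⟨ +-cong (+-comm x 1#) (⁻¹-∙-comm 1# y) ⟨
    (x + 1#) + (- 1# + - y)   ≈⟨ +-assoc x 1# _ ⟩
    x + (1# + (- 1# + - y))   ≈⟨ +-congˡ (+-assoc 1# (- 1#) (- y)) ⟨
    x + ((1# + - 1#) + - y)   ≈⟨ +-congˡ (+-congʳ (-‿inverseʳ 1#)) ⟩
    x + (0# + - y)            ≈⟨ +-congˡ (+-identityˡ (- y)) ⟩
    x - y                     ∎

  fromℤ-⊖ : ∀ m n → fromℤ (m ⊖ n) ≈ m · 1# - n · 1#
  fromℤ-⊖ m zero = sym (trans (+-congˡ ε⁻¹≈ε) (+-identityʳ _))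
  fromℤ-⊖ zero (suc n) = sym (+-identityˡ _)
  fromℤ-⊖ (suc m) (suc n) = begin
    fromℤ (suc m ⊖ suc n)             ≡⟨ ≡.cong fromℤ (ℤ.[1+m]⊖[1+n]≡m⊖n m n) ⟩
    fromℤ (m ⊖ n)                     ≈⟨ fromℤ-⊖ m n ⟩
    m · 1# - n · 1#                   ≈⟨ cancel-1+ _ _ ⟨
    (1# + m · 1#) - (1# + n · 1#)     ≈⟨ +-cong (1+× m 1#) (-‿cong (1+× n 1#)) ⟨
    suc m · 1# - suc n · 1#           ∎

  fromℤ-+ : ∀ i j → fromℤ (i ℤ.+ j) ≈ fromℤ i + fromℤ j
  fromℤ-+ (+ m) (+ n) = ×-homo-+ 1# m n
  fromℤ-+ (+ m) -[1+ n ] = fromℤ-⊖ m (suc n)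
  fromℤ-+ -[1+ m ] (+ n) = trans (fromℤ-⊖ n (suc m)) (+-comm _ _)
  fromℤ-+ i@(-[1+ m ]) j@(-[1+ n ]) = begin
    fromℤ (i ℤ.+ j)                        ≡⟨ ≡.cong fromℤ (ℤ.neg-distrib-+ (+ suc m) (+ suc n)) ⟨
    - ((suc m ℕ.+ suc n) · 1#)             ≈⟨ -‿cong (×-homo-+ 1# (suc m) (suc n)) ⟩
    - (suc m · 1# + suc n · 1#)            ≈⟨ ⁻¹-∙-comm _ _ ⟨
    fromℤ i + fromℤ j                      ∎

  fromℤ-neg : ∀ i → fromℤ (ℤ.- i) ≈ - fromℤ i
  fromℤ-neg (+ zero) = sym ε⁻¹≈ε
  fromℤ-neg (+ suc n) = refl
  fromℤ-neg -[1+ n ] = sym (⁻¹-involutive _)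

  fromℤ-homo : ℤ.+-*-rawRing -Raw-AlmostCommutative⟶ fromCommutativeRing R
  fromℤ-homo = record
    { ⟦_⟧ = fromℤ ; +-homo = fromℤ-+ ; *-homo = fromℤ-* ; -‿homo = fromℤ-neg
    ; 0-homo = refl ; 1-homo = refl }

  fromℤ-≟ : WeaklyDecidable (λ i j → fromℤ i ≈ fromℤ j)
  fromℤ-≟ i j with i ℤ.≟ j
  ... | yes ≡.refl = just refl
  ... | no _ = nothing

  open Algebra.Solver.Ring ℤ.+-*-rawRing (fromCommutativeRing R) fromℤ-homo fromℤ-≟ public
    using (solve; con; _:+_; _:*_; _:-_; :-_; _:=_)

-- Vizing's theorem by fans and Kempe chains.

module EdgeColouringTheorem where
  open import Data.Nat using (_+_; _*_)
  open import Relation.Binary.PropositionalEquality using (refl; sym; trans; cong; subst)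

  least : ∀ {p} {P : ℕ → Set p} → (∀ i → Dec (P i)) → ∀ {N} → P N →
    Σ[ j ∈ ℕ ] j ≤ N × P j × (∀ {i} → i < j → ¬ P i)
  least {P = P} P? {N} pN with P? 0
  ... | yes p0 = 0 , z≤n , p0 , λ ()
  least P? {zero} pN | no ¬p0 = ⊥-elim (¬p0 pN)
  least {P = P} P? {suc N} pN | no ¬p0 with least {P = P ∘ suc} (P? ∘ suc) pN
  ... | j , j≤N , pj , below = suc j , s≤s j≤N , pj , below-suc
    where
    below-suc : ∀ {i} → i < suc j → ¬ P i
    below-suc {zero} _ = ¬p0
    below-suc {suc i} (s≤s i<j) = below i<j

  fold-period : ∀ {a} {A : Set a} (s : A → A) x m → fold x s m ≡ x → ∀ q → fold x s (q * m) ≡ x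
  fold-period s x m e zero = refl
  fold-period s x m e (suc q) = trans (fold-+ x s m) (trans (cong (λ z → fold z s m) (fold-period s x m e q)) e)

  -- Two involutions f and g generate a dihedral action: on the orbit of a fixed
  -- point x of f, a fixed point of g is a reflection centre, and g ∘ f has odd
  -- order there, so there is only one such centre.
  module _ {a} {A : Set a} (f g : A → A) (ff : ∀ v → f (f v) ≡ v) (gg : ∀ v → g (g v) ≡ v)
           (x : A) (fx : f x ≡ x) where

    private
      _^x : ℕ → A
      t ^x = fold x (f ∘ g) t
      split : ∀ m {n} → (m + n) ^x ≡ fold (n ^x) (f ∘ g) m
      split = fold-+ x (f ∘ g)

    -- Conjugation by `g` inverts `f ∘ g`, so the composite of (f g)^(t+1), `g` and (f g)^t is just
    -- `f`, which fixes `x`.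
    unwind : ∀ t → fold (g (t ^x)) (f ∘ g) (suc t) ≡ x
    unwind zero = trans (cong f (gg x)) fx
    unwind (suc t) = trans (shift (suc t) _) (trans (cong (λ z → fold z (f ∘ g) (suc t)) step) (unwind t))
      where
      shift : ∀ n z → fold z (f ∘ g) (suc n) ≡ fold (f (g z)) (f ∘ g) n
      shift zero z = refl
      shift (suc n) z = cong (f ∘ g) (shift n z)
      step : f (g (g (f (g (t ^x))))) ≡ g (t ^x)
      step = trans (cong f (gg _)) (ff _)

    odd-period : ∀ s → g (s ^x) ≡ s ^x → (suc s + s) ^x ≡ x
    odd-period s e = trans (split (suc s)) (trans (cong (λ z → fold z (f ∘ g) (suc s)) (sym e)) (unwind s))

    -- Both 2s+1 and 2(r+s)+1 are periods of `x`, hence so is their difference 2r. As r + s(2r) =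
    -- r(2s+1), r is a period too.
    centre-unique-+ : ∀ s r → g (s ^x) ≡ s ^x → g ((r + s) ^x) ≡ (r + s) ^x → (r + s) ^x ≡ s ^x
    centre-unique-+ s r es et =
      trans (cong _^x (ℕ.+-comm r s)) (trans (split s) (cong (λ z → fold z (f ∘ g) s) r-period))
      where
      even-period : (r + r) ^x ≡ x
      even-period = trans (cong (λ z → fold z (f ∘ g) (r + r)) (sym (odd-period s es)))
        (trans (sym (split (r + r))) (trans (cong _^x (arith r s)) (odd-period (r + s) et)))
        where
        arith : ∀ r s → (r + r) + (suc s + s) ≡ suc (r + s) + (r + s)
        arith = solve-∀
      r-period : r ^x ≡ x
      r-period = trans (cong (λ z → fold z (f ∘ g) r) (sym (fold-period _ x (r + r) even-period s)))
        (trans (sym (split r)) (trans (cong _^x (arith r s)) (fold-period _ x (suc s + s) (odd-period s es) r)))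
        where
        arith : ∀ r s → r + s * (r + r) ≡ r * (suc s + s)
        arith = solve-∀

    centre-unique : ∀ s t → g (s ^x) ≡ s ^x → g (t ^x) ≡ t ^x → s ^x ≡ t ^x
    centre-unique s t es et with ℕ.≤-total s t
    ... | inj₁ s≤t = sym (subst (λ m → m ^x ≡ s ^x) (ℕ.m∸n+n≡m s≤t)
            (centre-unique-+ s (t ∸ s) es (subst (λ m → g (m ^x) ≡ m ^x) (sym (ℕ.m∸n+n≡m s≤t)) et)))
    ... | inj₂ t≤s = subst (λ m → m ^x ≡ t ^x) (ℕ.m∸n+n≡m t≤s)
            (centre-unique-+ t (s ∸ t) et (subst (λ m → g (m ^x) ≡ m ^x) (sym (ℕ.m∸n+n≡m t≤s)) es))

  module Vizing {ℓᵉ : Level} {n k : ℕ} (E : Fin n → Fin n → Set ℓᵉ)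
    (E-sym : ∀ {a b} → E a b → E b a) (E-irrefl : ∀ {a} → ¬ E a a) where

    V C : Set
    V = Fin n
    C = Fin k

    -- A partial proper edge colouring: mate c v is the neighbour joined to v by
    -- colour c, or v itself if c is missing at v.
    record Colouring : Set ℓᵉ where
      field
        mate : C → V → V
        invol : ∀ c v → mate c (mate c v) ≡ v
        sound : ∀ c v → mate c v ≢ v → E v (mate c v)
        uniq : ∀ c d v → mate c v ≢ v → mate c v ≡ mate d v → c ≡ d

    open Colouring

    Coloured : Colouring → V → V → Set
    Coloured M a b = ∃ λ c → mate M c a ≡ b

    Coloured-sym : ∀ M {a b} → Coloured M a b → Coloured M b a
    Coloured-sym M {a} (c , refl) = c , invol M c a

    empty : Colouring
    empty = record
      { mate = λ _ v → v
      ; invol = λ _ _ → refl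
      ; sound = λ _ _ v≢v → ⊥-elim (v≢v refl)
      ; uniq = λ _ _ _ v≢v → ⊥-elim (v≢v refl)
      }

    module Rewire (f : V → V) (ff : ∀ v → f (f v) ≡ v) {x y : V} (x≢y : x ≢ y) (fy : f y ≡ y) where

      -- Adds the pair {x, y} to the matching `f` and drops the pair of `x`, if there is one; the
      -- former partner `f x` becomes unmatched.
      rewire : V → V
      rewire v with v Fin.≟ x | v Fin.≟ y | v Fin.≟ f x
      ... | yes _ | _     | _     = y
      ... | no _  | yes _ | _     = x
      ... | no _  | no _  | yes _ = v
      ... | no _  | no _  | no _  = f v

      rewire-x : rewire x ≡ y
      rewire-x with x Fin.≟ x | x Fin.≟ y | x Fin.≟ f x
      ... | yes _ | _ | _ = refl
      ... | no x≢x | _ | _ = ⊥-elim (x≢x refl)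

      rewire-y : rewire y ≡ x
      rewire-y with y Fin.≟ x | y Fin.≟ y | y Fin.≟ f x
      ... | yes y≡x | _ | _ = ⊥-elim (x≢y (sym y≡x))
      ... | no _ | yes _ | _ = refl
      ... | no _ | no y≢y | _ = ⊥-elim (y≢y refl)

      rewire-fx : ∀ {v} → v ≢ x → v ≢ y → v ≡ f x → rewire v ≡ v
      rewire-fx {v} v≢x v≢y v≡fx with v Fin.≟ x | v Fin.≟ y | v Fin.≟ f x
      ... | yes v≡x | _ | _ = ⊥-elim (v≢x v≡x)
      ... | no _ | yes v≡y | _ = ⊥-elim (v≢y v≡y)
      ... | no _ | no _ | yes _ = refl
      ... | no _ | no _ | no v≢fx = ⊥-elim (v≢fx v≡fx)

      rewire-else : ∀ {v} → v ≢ x → v ≢ y → v ≢ f x → rewire v ≡ f v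
      rewire-else {v} v≢x v≢y v≢fx with v Fin.≟ x | v Fin.≟ y | v Fin.≟ f x
      ... | yes v≡x | _ | _ = ⊥-elim (v≢x v≡x)
      ... | no _ | yes v≡y | _ = ⊥-elim (v≢y v≡y)
      ... | no _ | no _ | yes v≡fx = ⊥-elim (v≢fx v≡fx)
      ... | no _ | no _ | no _ = refl

      data Position (v : V) : Set where
        at-x : v ≡ x → Position v
        at-y : v ≡ y → Position v
        at-fx : v ≢ x → v ≢ y → v ≡ f x → Position v
        elsewhere : v ≢ x → v ≢ y → v ≢ f x → Position v

      position : ∀ v → Position v
      position v with v Fin.≟ x | v Fin.≟ y | v Fin.≟ f x
      ... | yes p | _ | _ = at-x p
      ... | no _ | yes p | _ = at-y p
      ... | no p | no q | yes r = at-fx p q r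
      ... | no p | no q | no r = elsewhere p q r

      rewire-invol : ∀ v → rewire (rewire v) ≡ v
      rewire-invol v with position v
      ... | at-x refl = trans (cong rewire rewire-x) rewire-y
      ... | at-y refl = trans (cong rewire rewire-y) rewire-x
      ... | at-fx p q r = trans (cong rewire (rewire-fx p q r)) (rewire-fx p q r)
      ... | elsewhere p q r = trans (cong rewire (rewire-else p q r)) (trans (rewire-else p′ q′ r′) (ff v))
        where
        p′ : f v ≢ x
        p′ e = r (trans (sym (ff v)) (cong f e))
        q′ : f v ≢ y
        q′ e = q (trans (sym (ff v)) (trans (cong f e) fy))
        r′ : f v ≢ f x
        r′ e = p (trans (sym (ff v)) (trans (cong f e) (ff x)))

      rewire-fixed : ∀ {v} → v ≢ x → v ≢ y → f v ≡ v → rewire v ≡ v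
      rewire-fixed {v} v≢x v≢y fv with position v
      ... | at-x p = ⊥-elim (v≢x p)
      ... | at-y p = ⊥-elim (v≢y p)
      ... | at-fx p q r = rewire-fx p q r
      ... | elsewhere p q r = trans (rewire-else p q r) fv

    module Recolour (M : Colouring) (β : C) {x y : V} (Exy : E x y)
                    (fresh : ¬ Coloured M x y) (free : mate M β y ≡ y) where

      x≢y : x ≢ y
      x≢y refl = E-irrefl Exy

      open Rewire (mate M β) (invol M β) x≢y free

      mate′ : C → V → V
      mate′ c v with c Fin.≟ β
      ... | yes _ = rewire v
      ... | no _ = mate M c v

      mate′-β : ∀ v → mate′ β v ≡ rewire v
      mate′-β v with β Fin.≟ β
      ... | yes _ = refl
      ... | no β≢β = ⊥-elim (β≢β refl)

      mate′-≢ : ∀ {c} → c ≢ β → ∀ v → mate′ c v ≡ mate M c v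
      mate′-≢ {c} c≢β v with c Fin.≟ β
      ... | yes c≡β = ⊥-elim (c≢β c≡β)
      ... | no _ = refl

      invol′ : ∀ c v → mate′ c (mate′ c v) ≡ v
      invol′ c v with c Fin.≟ β
      ... | yes _ = rewire-invol v
      ... | no _ = invol M c v

      sound-rewire : ∀ v → rewire v ≢ v → E v (rewire v)
      sound-rewire v ne with position v
      ... | at-x refl = subst (E x) (sym rewire-x) Exy
      ... | at-y refl = subst (E y) (sym rewire-y) (E-sym Exy)
      ... | at-fx p q r = ⊥-elim (ne (rewire-fx p q r))
      ... | elsewhere p q r = subst (E v) (sym e) (sound M β v (λ fv → ne (trans e fv)))
        where e = rewire-else p q r

      sound′ : ∀ c v → mate′ c v ≢ v → E v (mate′ c v)
      sound′ c v with c Fin.≟ β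
      ... | yes _ = sound-rewire v
      ... | no _ = sound M c v

      uniq-rewire : ∀ d v → rewire v ≢ v → rewire v ≡ mate M d v → β ≡ d
      uniq-rewire d v ne eq with position v
      ... | at-x refl = ⊥-elim (fresh (d , trans (sym eq) rewire-x))
      ... | at-y refl = ⊥-elim (fresh (Coloured-sym M (d , trans (sym eq) rewire-y)))
      ... | at-fx p q r = ⊥-elim (ne (rewire-fx p q r))
      ... | elsewhere p q r = uniq M β d v (λ fv → ne (trans e fv)) (trans (sym e) eq)
        where e = rewire-else p q r

      uniq′ : ∀ c d v → mate′ c v ≢ v → mate′ c v ≡ mate′ d v → c ≡ d
      uniq′ c d v ne eq with c Fin.≟ β | d Fin.≟ β
      ... | yes refl | yes refl = refl
      ... | yes refl | no _ = uniq-rewire d v ne eq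
      ... | no _ | yes refl = sym (uniq-rewire c v (λ e → ne (trans eq e)) (sym eq))
      ... | no _ | no _ = uniq M c d v ne eq

      recoloured : Colouring
      recoloured = record { mate = mate′ ; invol = invol′ ; sound = sound′ ; uniq = uniq′ }

      mate′-x : mate′ β x ≡ y
      mate′-x = trans (mate′-β x) rewire-x

      free-preserved : ∀ c {v} → v ≢ x → v ≢ y → mate M c v ≡ v → mate′ c v ≡ v
      free-preserved c {v} v≢x v≢y fr with c Fin.≟ β
      ... | yes refl = rewire-fixed v≢x v≢y fr
      ... | no _ = fr

      -- Only the old β-edge at `x` can lose its colour, since β was missing at `y`; the last two
      -- alternatives are its two orientations.
      coloured-preserved : ∀ {a b} → a ≢ b → Coloured M a b →
        Coloured recoloured a b ⊎ (a ≡ x × b ≡ mate M β x) ⊎ (a ≡ mate M β x × b ≡ x)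
      coloured-preserved {a} a≢b (c , refl) with c Fin.≟ β
      ... | no c≢β = inj₁ (c , mate′-≢ c≢β a)
      ... | yes refl with position a
      ...   | at-x refl = inj₂ (inj₁ (refl , refl))
      ...   | at-y refl = ⊥-elim (a≢b (sym free))
      ...   | at-fx p q refl = inj₂ (inj₂ (refl , invol M β x))
      ...   | elsewhere p q r = inj₁ (β , trans (mate′-β a) (rewire-else p q r))

    -- The case a = b is excluded because `Coloured M a a` merely says that some colour is missing
    -- at a, which need not persist.
    _⊑_ : Colouring → Colouring → Set
    M ⊑ M′ = ∀ {a b} → a ≢ b → Coloured M a b → Coloured M′ a b

    -- A Vizing fan at `x` with uncoloured first edge. Indexing by ℕ rather than by a list makes
    -- truncation a change of `j` and dropping the first vertex a composition with `suc`.
    record Fan (M : Colouring) (x : V) (y : ℕ → V) (c : ℕ → C) (j : ℕ) (α : C) : Set where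
      field
        free : ∀ {i} → i < j → mate M (c i) (y i) ≡ y i
        free-end : mate M α (y j) ≡ y j
        free-x : mate M α x ≡ x
        link : ∀ {i} → i < j → mate M (c i) x ≡ y (suc i)
        off : ∀ {i} → i ≤ j → y i ≢ x
        distinct : ∀ {i l} → i < l → l ≤ j → y i ≢ y l

    -- Giving `c 0` to the first edge takes it from the edge to `y 1`, which becomes the uncoloured
    -- first edge of a fan one shorter. In the end `α`, missing at both ends, costs no edge its
    -- colour.
    fan-augment : ∀ j M {x y c α} → Fan M x y c j α → E x (y 0) → ¬ Coloured M x (y 0) →
      Σ[ M′ ∈ Colouring ] M ⊑ M′ × Coloured M′ x (y 0)
    fan-augment zero M {x} {y} {c} {α} F Exy fresh = recoloured , kept , (α , mate′-x)
      where
      open Fan F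
      open Recolour M α Exy fresh free-end
      kept : M ⊑ recoloured
      kept a≢b col with coloured-preserved a≢b col
      ... | inj₁ col′ = col′
      ... | inj₂ (inj₁ (refl , b≡)) = ⊥-elim (a≢b (sym (trans b≡ free-x)))
      ... | inj₂ (inj₂ (a≡ , refl)) = ⊥-elim (a≢b (trans a≡ free-x))
    fan-augment (suc j) M {x} {y} {c} {α} F Exy fresh =
      proj₁ rest , kept , proj₁ (proj₂ rest) x≢y (c 0 , mate′-x)
      where
      open Fan F
      open Recolour M (c 0) Exy fresh (free z<s)
      y₁ : mate M (c 0) x ≡ y 1
      y₁ = link z<s
      moved : mate M (c 0) x ≢ x
      moved e = off (s≤s z≤n) (trans (sym y₁) e)
      α≢ : α ≢ c 0
      α≢ refl = moved free-x
      c≢ : ∀ {i} → i < j → c (suc i) ≢ c 0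
      c≢ i<j e = distinct (s<s z<s) (s≤s i<j)
        (trans (sym y₁) (trans (cong (λ d → mate M d x) (sym e)) (link (s<s i<j))))
      F′ : Fan recoloured x (y ∘ suc) (c ∘ suc) j α
      F′ = record
        { free = λ i<j → free-preserved _ (off (ℕ.<⇒≤ (s<s i<j))) (≢-sym (distinct z<s (ℕ.<⇒≤ (s<s i<j)))) (free (s<s i<j))
        ; free-end = free-preserved α (off ℕ.≤-refl) (≢-sym (distinct z<s ℕ.≤-refl)) free-end
        ; free-x = trans (mate′-≢ α≢ x) free-x
        ; link = λ i<j → trans (mate′-≢ (c≢ i<j) x) (link (s<s i<j))
        ; off = λ i≤j → off (s≤s i≤j)
        ; distinct = λ i<l l≤j → distinct (s<s i<l) (s≤s l≤j)
        }
      fresh′ : ¬ Coloured recoloured x (y 1)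
      fresh′ (d , e) with d Fin.≟ c 0
      ... | yes refl = distinct z<s (s≤s z≤n) (trans (sym rx) e)
        where rx = Rewire.rewire-x (mate M (c 0)) (invol M (c 0)) x≢y (free z<s)
      ... | no d≢ = d≢ (sym (uniq M (c 0) d x moved (trans y₁ (sym e))))
      rest : Σ[ M′ ∈ Colouring ] recoloured ⊑ M′ × Coloured M′ x (y 1)
      rest = fan-augment j recoloured F′ (subst (E x) y₁ (sound M (c 0) x moved)) fresh′
      kept : M ⊑ proj₁ rest
      kept a≢b col with coloured-preserved a≢b col
      ... | inj₁ col′ = proj₁ (proj₂ rest) a≢b col′
      ... | inj₂ (inj₁ (refl , b≡)) = subst (Coloured (proj₁ rest) x) (sym (trans b≡ y₁)) (proj₂ (proj₂ rest))
      ... | inj₂ (inj₂ (a≡ , refl)) =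
        subst (λ a → Coloured (proj₁ rest) a x) (sym (trans a≡ y₁)) (Coloured-sym (proj₁ rest) (proj₂ (proj₂ rest)))

    module Kempe (M : Colouring) (α β : C) {W : V → Set} (W? : ∀ v → Dec (W v))
                 (closed-α : ∀ {v} → W v → W (mate M α v)) (closed-β : ∀ {v} → W v → W (mate M β v)) where

      swap : C → C
      swap c with c Fin.≟ α | c Fin.≟ β
      ... | yes _ | _ = β
      ... | no _ | yes _ = α
      ... | no _ | no _ = c

      swap-α : swap α ≡ β
      swap-α with α Fin.≟ α | α Fin.≟ β
      ... | yes _ | _ = refl
      ... | no α≢α | _ = ⊥-elim (α≢α refl)

      swap-β : swap β ≡ α
      swap-β with β Fin.≟ α | β Fin.≟ β
      ... | yes β≡α | _ = β≡α
      ... | no _ | yes _ = refl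
      ... | no _ | no β≢β = ⊥-elim (β≢β refl)

      swap-≢ : ∀ {c} → c ≢ α → c ≢ β → swap c ≡ c
      swap-≢ {c} c≢α c≢β with c Fin.≟ α | c Fin.≟ β
      ... | yes c≡α | _ = ⊥-elim (c≢α c≡α)
      ... | no _ | yes c≡β = ⊥-elim (c≢β c≡β)
      ... | no _ | no _ = refl

      swap-invol : ∀ c → swap (swap c) ≡ c
      swap-invol c = by-cases (c Fin.≟ α) (c Fin.≟ β)
        where
        by-cases : Dec (c ≡ α) → Dec (c ≡ β) → swap (swap c) ≡ c
        by-cases (yes refl) _ = trans (cong swap swap-α) swap-β
        by-cases _ (yes refl) = trans (cong swap swap-β) swap-α
        by-cases (no p) (no q) = trans (cong swap (swap-≢ p q)) (swap-≢ p q)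

      swap-moves⇒closed : ∀ c → swap c ≢ c → ∀ {v} → W v → W (mate M c v) × W (mate M (swap c) v)
      swap-moves⇒closed c moves = by-cases (c Fin.≟ α) (c Fin.≟ β)
        where
        by-cases : Dec (c ≡ α) → Dec (c ≡ β) → ∀ {v} → W v → W (mate M c v) × W (mate M (swap c) v)
        by-cases (yes refl) _ w = closed-α w , subst (λ d → W (mate M d _)) (sym swap-α) (closed-β w)
        by-cases _ (yes refl) w = closed-β w , subst (λ d → W (mate M d _)) (sym swap-β) (closed-α w)
        by-cases (no p) (no q) w = ⊥-elim (moves (swap-≢ p q))

      relabel : V → C → C
      relabel v c with W? v
      ... | yes _ = swap c
      ... | no _ = c

      relabel-invol : ∀ v c → relabel v (relabel v c) ≡ c
      relabel-invol v c with W? v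
      ... | yes _ = swap-invol c
      ... | no _ = refl

      -- If `swap` moves c, closure of `W` puts both ends of an edge on the same side; if not,
      -- relabelling is trivial everywhere. So the two ends agree on the new colour, and the swapped
      -- mates are involutions.
      relabel-mate : ∀ c v → relabel (mate M (relabel v c) v) c ≡ relabel v c
      relabel-mate c v with swap c Fin.≟ c
      relabel-mate c v | yes e = trans (relabel-same _) (sym (relabel-same v))
        where
        relabel-same : ∀ u → relabel u c ≡ c
        relabel-same u with W? u
        ... | yes _ = e
        ... | no _ = refl
      relabel-mate c v | no moves with W? v
      ... | yes w with W? (mate M (swap c) v)
      ...   | yes _ = refl
      ...   | no ¬w = ⊥-elim (¬w (proj₂ (swap-moves⇒closed c moves w)))
      relabel-mate c v | no moves | no ¬w with W? (mate M c v)
      ...   | yes w = ⊥-elim (¬w (subst W (invol M c v) (proj₁ (swap-moves⇒closed c moves w))))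
      ...   | no _ = refl

      swapped : Colouring
      swapped = record
        { mate = λ c v → mate M (relabel v c) v
        ; invol = λ c v → trans (cong (λ d → mate M d (mate M (relabel v c) v)) (relabel-mate c v)) (invol M (relabel v c) v)
        ; sound = λ c v → sound M (relabel v c) v
        ; uniq = λ c d v ne eq → trans (sym (relabel-invol v c))
            (trans (cong (relabel v) (uniq M (relabel v c) (relabel v d) v ne eq)) (relabel-invol v d))
        }

      swapped-⊑ : ∀ {a b} → Coloured M a b → Coloured swapped a b
      swapped-⊑ {a} (c , e) = relabel a c , trans (cong (λ d → mate M d a) (relabel-invol a c)) e

      swapped-⊒ : ∀ {a b} → Coloured swapped a b → Coloured M a b
      swapped-⊒ {a} (c , e) = relabel a c , e

      swapped-outside : ∀ {v} → ¬ W v → ∀ c → mate swapped c v ≡ mate M c v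
      swapped-outside {v} ¬w c with W? v
      ... | yes w = ⊥-elim (¬w w)
      ... | no _ = refl

      swapped-≢ : ∀ {c} → c ≢ α → c ≢ β → ∀ v → mate swapped c v ≡ mate M c v
      swapped-≢ c≢α c≢β v with W? v
      ... | yes _ = cong (λ d → mate M d v) (swap-≢ c≢α c≢β)
      ... | no _ = refl

      swapped-α : ∀ {v} → W v → mate swapped α v ≡ mate M β v
      swapped-α {v} w with W? v
      ... | yes _ = cong (λ d → mate M d v) swap-α
      ... | no ¬w = ⊥-elim (¬w w)

    module Augment (dec : (P : Set) → Dec P) (missing : ∀ M v → ∃ λ c → mate M c v ≡ v)
                   (M : Colouring) {x y₀ : V} (Exy : E x y₀) (fresh : ¬ Coloured M x y₀) where

      Goal : Set ℓᵉ
      Goal = Σ[ M′ ∈ Colouring ] M ⊑ M′ × Coloured M′ x y₀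

      m : V → C
      m v = proj₁ (missing M v)

      m-free : ∀ v → mate M (m v) v ≡ v
      m-free v = proj₂ (missing M v)

      -- An unbounded sequence that is a fan only up to its first stop: beyond it vertices may recur
      -- or equal `x`.
      y : ℕ → V
      y = fold y₀ (λ v → mate M (m v) x)

      Stop : ℕ → Set
      Stop j = mate M (m (y j)) x ≡ x ⊎ ∃ λ i → i < j × m (y i) ≡ m (y j)

      stops : ∃ Stop
      -- Among k + 1 fan vertices two have the same chosen missing colour.
      stops with Fin.pigeonhole (ℕ.n<1+n k) (m ∘ y ∘ toℕ)
      ... | i , j , i<j , eq = toℕ j , inj₂ (toℕ i , i<j , eq)

      module FirstStop (j : ℕ) (go-on : ∀ {i} → i < j → ¬ Stop i) where

        moved : ∀ {i} → i < j → mate M (m (y i)) x ≢ x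
        moved i<j e = go-on i<j (inj₁ e)

        off : ∀ {i} → i ≤ j → y i ≢ x
        off {zero} _ refl = E-irrefl Exy
        off {suc i} i<j e = moved i<j e

        -- Returning to `y 0` would mean that its edge to `x` is coloured. A later coincidence makes
        -- two edges at `x` equal, hence their colours equal, which is a stop before `j`.
        distinct : ∀ {i l} → i < l → l ≤ j → y i ≢ y l
        distinct {zero} {suc l} _ _ e = fresh (m (y l) , sym e)
        distinct {suc i} {suc l} (s≤s i<l) l<j e =
          go-on l<j (inj₂ (i , i<l , uniq M _ _ x (moved (ℕ.<-trans i<l l<j)) e))

        rotate : mate M (m (y j)) x ≡ x → Goal
        rotate free-x = fan-augment j M F Exy fresh
          where
          F : Fan M x y (m ∘ y) j (m (y j))
          F = record { free = λ _ → m-free _ ; free-end = m-free _ ; free-x = free-x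
                     ; link = λ _ → refl ; off = off ; distinct = distinct }

        -- The αβ-chain through x does not contain both y i and y j, so swapping α
        -- and β off that chain makes α missing at one of them as well as at x.
        module Repeat {i} (i<j : i < j) (same : m (y i) ≡ m (y j)) where

          α β : C
          α = m x
          β = m (y j)

          f g : V → V
          f = mate M α
          g = mate M β

          orbit : ℕ → V
          orbit = fold x (f ∘ g)

          -- Nonnegative iterates give the whole component: `f` fixes `orbit 0` and sends
          -- `orbit (suc t)` back to `g (orbit t)`.
          Chain : V → Set
          Chain v = ∃ λ t → v ≡ orbit t ⊎ v ≡ g (orbit t)

          Chain-g : ∀ {v} → Chain v → Chain (g v)
          Chain-g (t , inj₁ refl) = t , inj₂ refl
          Chain-g (t , inj₂ refl) = t , inj₁ (invol M β _)

          Chain-f : ∀ {v} → Chain v → Chain (f v)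
          Chain-f (zero , inj₁ refl) = 0 , inj₁ (m-free x)
          Chain-f (suc t , inj₁ refl) = t , inj₂ (invol M α _)
          Chain-f (t , inj₂ refl) = suc t , inj₁ refl

          orbit-of : ∀ {v} → g v ≡ v → Chain v → ∃ λ t → v ≡ orbit t
          orbit-of gv (t , inj₁ e) = t , e
          orbit-of gv (t , inj₂ e) = t , trans (sym gv) (trans (cong g e) (invol M β _))

          centre : ∀ l → m (y l) ≡ β → g (y l) ≡ y l
          centre l e = subst (λ c → mate M c (y l) ≡ y l) e (m-free (y l))

          -- β is missing at both vertices, so on the chain each would be a fixed point of `g`, and
          -- there is only one.
          not-both : Chain (y i) → Chain (y j) → ⊥
          not-both ci cj with orbit-of (centre i same) ci | orbit-of (centre j refl) cj
          ... | s , es | t , et = distinct i<j ℕ.≤-refl (trans es (trans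
                (centre-unique f g (invol M α) (invol M β) x (m-free x) s t
                  (subst (λ v → g v ≡ v) es (centre i same)) (subst (λ v → g v ≡ v) et (centre j refl)))
                (sym et)))

          W : V → Set
          W v = ¬ Chain v

          W? : ∀ v → Dec (W v)
          W? v = dec (W v)

          open Kempe M α β W? (λ {v} ¬c c → ¬c (subst Chain (invol M α v) (Chain-f c)))
                              (λ {v} ¬c c → ¬c (subst Chain (invol M β v) (Chain-g c)))

          Target : ℕ → Set
          Target l = m (y l) ≡ β × W (y l)

          target : ∃ λ l → l ≤ j × Target l
          target with dec (Chain (y j))
          ... | no ¬cj = j , ℕ.≤-refl , refl , ¬cj
          ... | yes cj = i , ℕ.<⇒≤ i<j , same , λ ci → not-both ci cj

          module FirstTarget (l : ℕ) (l≤j : l ≤ j) (hit : Target l) (miss : ∀ {i} → i < l → ¬ Target i) where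

            α-not : ∀ {i} → i < l → m (y i) ≢ α
            α-not i<l e = moved (ℕ.<-≤-trans i<l l≤j) (trans (cong (λ c → mate M c x) e) (m-free x))

            -- Before the first target, a vertex with missing colour β lies on the chain and is
            -- untouched by the swap. None has missing colour α, as α is missing at `x` and the fan
            -- would have stopped there.
            still-free : ∀ {i} → i < l → mate swapped (m (y i)) (y i) ≡ y i
            still-free {i} i<l = by-cases (m (y i) Fin.≟ β) (W? (y i))
              where
              by-cases : Dec (m (y i) ≡ β) → Dec (W (y i)) → mate swapped (m (y i)) (y i) ≡ y i
              by-cases (no ≢β) _ = trans (swapped-≢ (α-not i<l) ≢β (y i)) (m-free (y i))
              by-cases (yes ≡β) (yes w) = ⊥-elim (miss i<l (≡β , w))
              by-cases (yes _) (no ¬w) = trans (swapped-outside ¬w _) (m-free (y i))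

            x-outside : ¬ W x
            x-outside w = w (0 , inj₁ refl)

            F : Fan swapped x y (m ∘ y) l α
            F = record
              { free = still-free
              ; free-end = trans (swapped-α (proj₂ hit)) (centre l (proj₁ hit))
              ; free-x = trans (swapped-outside x-outside α) (m-free x)
              ; link = λ _ → swapped-outside x-outside _
              ; off = λ i≤l → off (ℕ.≤-trans i≤l l≤j)
              ; distinct = λ i<i′ i′≤l → distinct i<i′ (ℕ.≤-trans i′≤l l≤j)
              }

            swap-and-rotate : Goal
            swap-and-rotate with fan-augment l swapped F Exy (fresh ∘ swapped-⊒)
            ... | M′ , ext , col = M′ , (λ a≢b → ext a≢b ∘ swapped-⊑) , col

      augment : Goal
      augment with least (dec ∘ Stop) (proj₂ stops)
      ... | j , _ , inj₁ free-x , go-on = FirstStop.rotate j go-on free-x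
      ... | j , _ , inj₂ (i , i<j , same) , go-on with least (dec ∘ Target) (proj₂ (proj₂ target))
        where open FirstStop.Repeat j go-on i<j same
      ...   | l , l≤ , hit , miss = FirstTarget.swap-and-rotate l (ℕ.≤-trans l≤ (proj₁ (proj₂ target))) hit miss
        where open FirstStop.Repeat j go-on i<j same

    -- Edges are coloured one at a time. The bound on the degrees enters through the last
    -- hypothesis: under every partial colouring each vertex still misses a colour.
    vizing : (∀ a b → Dec (E a b)) → (dec : (P : Set) → Dec P) → (∀ M v → ∃ λ c → mate M c v ≡ v) →
      Σ[ M ∈ Colouring ] (∀ {a b} → E a b → Coloured M a b)
    vizing E? dec missing with colour-all (cartesianProduct (allFin n) (allFin n))
      where
      colour-all : ∀ es → Σ[ M ∈ Colouring ] (∀ {a b} → (a , b) ∈ˡ es → E a b → Coloured M a b)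
      colour-all [] = empty , λ ()
      colour-all ((x , y) ∷ es) with colour-all es
      ... | M , all with E? x y | dec (Coloured M x y)
      ...   | no ¬Exy | _ = M , λ where
              (here refl) Exy → ⊥-elim (¬Exy Exy)
              (there ∈es) → all ∈es
      ...   | yes _ | yes col = M , λ where
              (here refl) _ → col
              (there ∈es) → all ∈es
      ...   | yes Exy | no fresh with Augment.augment dec missing M Exy fresh
      ...     | M′ , ext , col = M′ , λ where
                (here refl) _ → col
                (there ∈es) Eab → ext (λ { refl → E-irrefl Eab }) (all ∈es Eab)
    ... | M , all = M , all (∈-cartesianProduct⁺ (∈-allFin _) (∈-allFin _))

-- Fixed points of an involution and the parity of the underlying set.

module Parity where
  open import Data.Nat using (_+_; _*_)
  open import Relation.Binary.PropositionalEquality using (refl; sym; trans; cong; cong₂)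

  less equal : ∀ {n} → Fin n → Fin n → ℕ
  less i j with Fin.<-cmp i j
  ... | tri< _ _ _ = 1
  ... | tri≈ _ _ _ = 0
  ... | tri> _ _ _ = 0
  equal i j with i Fin.≟ j
  ... | yes _ = 1
  ... | no _ = 0

  equal-no : ∀ {n} {i j : Fin n} → i ≢ j → equal i j ≡ 0
  equal-no {i = i} {j} ne with i Fin.≟ j
  ... | yes e = ⊥-elim (ne e)
  ... | no _ = refl

  equal-yes : ∀ {n} {i j : Fin n} → i ≡ j → equal i j ≡ 1
  equal-yes {i = i} {j} e with i Fin.≟ j
  ... | yes _ = refl
  ... | no ne = ⊥-elim (ne e)

  trichotomy : ∀ {n} (i j : Fin n) → less i j + less j i + equal j i ≡ 1
  trichotomy i j with Fin.<-cmp i j | Fin.<-cmp j i | j Fin.≟ i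
  ... | tri< _ _ _ | tri> _ _ _ | no _ = refl
  ... | tri≈ _ _ _ | tri≈ _ _ _ | yes _ = refl
  ... | tri> _ _ _ | tri< _ _ _ | no _ = refl
  ... | tri< _ ne _ | _ | yes e = ⊥-elim (ne (sym e))
  ... | tri> _ ne _ | _ | yes e = ⊥-elim (ne (sym e))
  ... | tri≈ _ e _ | _ | no ne = ⊥-elim (ne (sym e))
  ... | _ | tri≈ _ e _ | no ne = ⊥-elim (ne e)
  ... | _ | tri< _ ne _ | yes e = ⊥-elim (ne e)
  ... | _ | tri> _ ne _ | yes e = ⊥-elim (ne e)
  ... | tri< p _ _ | tri< _ _ ¬p | no _ = ⊥-elim (¬p p)
  ... | tri> _ _ p | tri> ¬p _ _ | no _ = ⊥-elim (¬p p)

  module Involution {n : ℕ} (σ : Fin n → Fin n) (σσ : ∀ i → σ (σ i) ≡ i) where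
    open Algebra.Properties.CommutativeMonoid.Sum ℕ.+-0-commutativeMonoid

    below fixed : Fin n → ℕ
    below i = less i (σ i)
    fixed i = equal (σ i) i

    one-of-three : ∀ i → below i + below (σ i) + fixed i ≡ 1
    one-of-three i = trans (cong (λ j → below i + less (σ i) j + fixed i) (σσ i)) (trichotomy i (σ i))

    sum-ones : ∀ m → sum {m} (λ _ → 1) ≡ m
    sum-ones zero = refl
    sum-ones (suc m) = cong suc (sum-ones m)

    -- Each index is below, above or equal to its image, and reindexing by `σ` shows that the first
    -- two kinds are equally many.
    size : n ≡ 2 * sum below + sum fixed
    size = begin
      n                                                        ≡⟨ sum-ones n ⟨
      sum {n} (λ _ → 1)                                        ≡⟨ sum-cong-≗ one-of-three ⟨
      sum (λ i → below i + below (σ i) + fixed i)              ≡⟨ ∑-distrib-+ (λ i → below i + below (σ i)) fixed ⟩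
      sum (λ i → below i + below (σ i)) + sum fixed            ≡⟨ cong (_+ sum fixed) (∑-distrib-+ below (below ∘ σ)) ⟩
      sum below + sum (below ∘ σ) + sum fixed                  ≡⟨ cong (λ s → sum below + s + sum fixed) (sum-permute below (permutation σ σ σσ σσ)) ⟨
      sum below + sum below + sum fixed                        ≡⟨ cong (λ s → sum below + s + sum fixed) (ℕ.+-identityʳ (sum below)) ⟨
      2 * sum below + sum fixed                                ∎
      where open ≡.≡-Reasoning

    no-fixed⇒even : (∀ i → σ i ≢ i) → ∃ λ m → n ≡ 2 * m
    no-fixed⇒even none = sum below , trans size
      (trans (cong (λ s → 2 * sum below + s) (trans (sum-cong-≗ (equal-no ∘ none)) (sum-replicate-zero n))) (ℕ.+-identityʳ _))

  one-fixed⇒odd : ∀ {n} (σ : Fin n → Fin n) → (∀ i → σ (σ i) ≡ i) →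
    ∀ z → σ z ≡ z → (∀ i → σ i ≡ i → i ≡ z) → ∃ λ m → n ≡ suc (2 * m)
  one-fixed⇒odd {suc n} σ σσ z σz only = sum below , trans size (trans (cong (λ s → 2 * sum below + s) sum-fixed) (ℕ.+-comm _ 1))
    where
    open Involution σ σσ
    open Algebra.Properties.CommutativeMonoid.Sum ℕ.+-0-commutativeMonoid
    sum-fixed : sum fixed ≡ 1
    sum-fixed = trans (sum-remove {i = z} fixed) (cong₂ _+_ (equal-yes σz)
      (trans (sum-cong-≗ (λ j → equal-no (λ e → Fin.punchInᵢ≢i z j (only _ e)))) (sum-replicate-zero n)))

-- Quotient rings, decidability, and maximal ideals from the ascending chain condition.

module IdealTheory {c ℓ : Level} (R : CommutativeRing c ℓ) where
  open CommutativeRing R hiding (zero)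
  open IntegerSolver R

  neg-closed : ∀ (J : Ideal R) {x} → _∈_ R x J → _∈_ R (- x) J
  neg-closed J {x} x∈J =
    resp J (solve 1 (λ x → :- con (+ 1) :* x := :- x) refl x) (*-closed J (- 1#) x∈J)

  ≈⇒≡mod : ∀ (J : Ideal R) {x y} → x ≈ y → _≡[_]_ R x J y
  ≈⇒≡mod J {x} {y} x≈y = resp J (trans (sym (-‿inverseʳ y)) (+-congʳ (sym x≈y))) (zero∈ J)

  -- Keeping the carrier and coarsening only the equality makes units and edge colourings of this
  -- ring agree definitionally with the notions modulo `J`.
  quotient : Ideal R → CommutativeRing c (c ⊔ ℓ)
  quotient J = record
    { Carrier = Carrier
    ; _≈_ = λ x y → _≡[_]_ R x J y
    ; _+_ = _+_ ; _*_ = _*_ ; -_ = -_ ; 0# = 0# ; 1# = 1#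
    ; isCommutativeRing = record
      { isRing = record
        { +-isAbelianGroup = record
          { isGroup = record
            { isMonoid = record
              { isSemigroup = record
                { isMagma = record
                  { isEquivalence = record
                    { refl = ≈⇒≡mod J refl
                    ; sym = λ {x} {y} p → resp J
                        (solve 2 (λ x y → :- (x :- y) := y :- x) refl x y) (neg-closed J p)
                    ; trans = λ {x} {y} {z} p q → resp J
                        (solve 3 (λ x y z → (x :- y) :+ (y :- z) := x :- z) refl x y z) (+-closed J p q)
                    }
                  ; ∙-cong = λ {x} {y} {u} {v} p q → resp J
                      (solve 4 (λ x y u v → (x :- y) :+ (u :- v) := (x :+ u) :- (y :+ v)) refl x y u v)
                      (+-closed J p q)
                  }
                ; assoc = λ x y z → ≈⇒≡mod J (+-assoc x y z)
                }
              ; identity = (λ x → ≈⇒≡mod J (+-identityˡ x)) , (λ x → ≈⇒≡mod J (+-identityʳ x))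
              }
            ; inverse = (λ x → ≈⇒≡mod J (-‿inverseˡ x)) , (λ x → ≈⇒≡mod J (-‿inverseʳ x))
            ; ⁻¹-cong = λ {x} {y} p → resp J
                (solve 2 (λ x y → :- (x :- y) := (:- x) :- (:- y)) refl x y) (neg-closed J p)
            }
          ; comm = λ x y → ≈⇒≡mod J (+-comm x y)
          }
        ; *-cong = λ {x} {y} {u} {v} p q → resp J
            (solve 4 (λ x y u v → u :* (x :- y) :+ y :* (u :- v) := (x :* u) :- (y :* v)) refl x y u v)
            (+-closed J (*-closed J u p) (*-closed J y q))
        ; *-assoc = λ x y z → ≈⇒≡mod J (*-assoc x y z)
        ; *-identity = (λ x → ≈⇒≡mod J (*-identityˡ x)) , (λ x → ≈⇒≡mod J (*-identityʳ x))
        ; distrib = (λ x y z → ≈⇒≡mod J (distribˡ x y z)) , (λ x y z → ≈⇒≡mod J (distribʳ x y z))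
        }
      ; *-comm = λ x y → ≈⇒≡mod J (*-comm x y)
      }
    }

  lookup-≈ : ∀ (J : Ideal R) {gs q} → All (λ g → _∈_ R g J) gs → Any (q ≈_) gs → _∈_ R q J
  lookup-≈ J (g∈ ∷ _) (here q≈g) = resp J (sym q≈g) g∈
  lookup-≈ J (_ ∷ gs∈) (there q∈) = lookup-≈ J gs∈ q∈

  InSpan⇒∈ : ∀ (J : Ideal R) {gs x} → All (λ g → _∈_ R g J) gs → InSpan R gs x → _∈_ R x J
  InSpan⇒∈ J {gs} gs∈ (ps , qs∈ , x≈) = resp J (sym x≈) (sumProd∈ ps qs∈)
    where
    sumProd∈ : ∀ ps → All (λ pr → Any (λ g → proj₂ pr ≈ g) gs) ps → _∈_ R (sumProd R ps) J
    sumProd∈ [] [] = zero∈ J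
    sumProd∈ ((p , q) ∷ ps) (q∈ ∷ qs∈) = +-closed J (*-closed J p (lookup-≈ J gs∈ q∈)) (sumProd∈ ps qs∈)

  generators∈ : ∀ (J : Ideal R) ((gs , _) : IsFinitelyGenerated R J) → All (λ g → _∈_ R g J) gs
  generators∈ J (gs , span) = All.map gen∈ (All.tabulate (Any.map reflexive))
    where
    gen∈ : ∀ {g} → Any (g ≈_) gs → _∈_ R g J
    gen∈ {g} g∈ = proj₂ (span g)
      ((1# , g) ∷ [] , g∈ ∷ [] , solve 1 (λ g → g := con (+ 1) :* g :+ con (+ 0)) refl g)

  zeroIdeal : Ideal R
  zeroIdeal = record
    { _∈I = λ x → Lift c (x ≈ 0#)
    ; resp = λ e (lift p) → lift (trans (sym e) p)
    ; zero∈ = lift refl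
    ; +-closed = λ (lift p) (lift q) → lift (trans (+-cong p q) (+-identityˡ 0#))
    ; *-closed = λ r (lift p) → lift (trans (*-congˡ p) (zeroʳ r))
    }

  _orZero : Set (c ⊔ ℓ) → Ideal R
  A orZero = record
    { _∈I = λ x → x ≈ 0# ⊎ A
    ; resp = λ { x≈y (inj₁ x≈0) → inj₁ (trans (sym x≈y) x≈0) ; _ (inj₂ a) → inj₂ a }
    ; zero∈ = inj₁ refl
    ; +-closed = λ { (inj₁ p) (inj₁ q) → inj₁ (trans (+-cong p q) (+-identityˡ 0#))
                   ; (inj₂ a) _ → inj₂ a ; _ (inj₂ a) → inj₂ a }
    ; *-closed = λ { r (inj₁ p) → inj₁ (trans (*-congˡ p) (zeroʳ r)) ; r (inj₂ a) → inj₂ a }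
    }

  -- A generator of A orZero is either zero or a witness of A; if all are zero
  -- then 1# is not in the ideal.
  noetherian⇒dec : ¬ (1# ≈ 0#) → IsNoetherian R → (A : Set (c ⊔ ℓ)) → Dec A
  noetherian⇒dec 1≉0 noeth A = search gs∈
    where
    fg = noeth (A orZero)
    gs∈ = generators∈ (A orZero) fg
    scan : ∀ {gs} → All (λ g → g ≈ 0# ⊎ A) gs → All (λ g → Lift c (g ≈ 0#)) gs ⊎ A
    scan [] = inj₁ []
    scan (inj₂ a ∷ _) = inj₂ a
    scan (inj₁ z ∷ gs∈) with scan gs∈
    ... | inj₁ zs = inj₁ (lift z ∷ zs)
    ... | inj₂ a = inj₂ a
    search : All (λ g → g ≈ 0# ⊎ A) (proj₁ fg) → Dec A
    search gs∈ with scan gs∈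
    ... | inj₂ a = yes a
    ... | inj₁ zs = no λ a → 1≉0 (lower (InSpan⇒∈ zeroIdeal zs (proj₁ (proj₂ fg 1#) (inj₂ a))))

  adjoin : Ideal R → Carrier → Ideal R
  adjoin J x = record
    { _∈I = λ y → Σ[ r ∈ Carrier ] _≡[_]_ R y J (r * x)
    ; resp = λ y≈z (r , p) → r , resp J (+-congʳ y≈z) p
    ; zero∈ = 0# , resp J (solve 1 (λ x → con (+ 0) := con (+ 0) :- con (+ 0) :* x) refl x) (zero∈ J)
    ; +-closed = λ {y} {z} (r , p) (s , q) → r + s , resp J
        (solve 5 (λ x y z r s → (y :- r :* x) :+ (z :- s :* x) := (y :+ z) :- (r :+ s) :* x) refl x y z r s)
        (+-closed J p q)
    ; *-closed = λ t {y} (r , p) → t * r , resp J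
        (solve 4 (λ x y t r → t :* (y :- r :* x) := t :* y :- t :* r :* x) refl x y t r) (*-closed J t p)
    }

  ⊆-adjoin : ∀ J x → _⊆_ R J (adjoin J x)
  ⊆-adjoin J x y y∈J = 0# , resp J (solve 2 (λ x y → y := y :- con (+ 0) :* x) refl x y) y∈J

  ∈-adjoin : ∀ J x → _∈_ R x (adjoin J x)
  ∈-adjoin J x = 1# , resp J (solve 1 (λ x → con (+ 0) := x :- con (+ 1) :* x) refl x) (zero∈ J)

  module Noetherian (dec : (A : Set (c ⊔ ℓ)) → Dec A) (noeth : IsNoetherian R) where

    module Ascend {X : Set (c ⊔ ℓ)} (J : X → Ideal R) (x₀ : X) where

      Bigger : X → X → Set (c ⊔ ℓ)
      Bigger x y = _⊆_ R (J x) (J y) × (Σ[ r ∈ Carrier ] _∈_ R r (J y) × ¬ (_∈_ R r (J x)))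

      choose : ∀ x → Dec (Σ X (Bigger x)) → X
      choose x (yes (y , _)) = y
      choose x (no _) = x

      step : X → X
      step x = choose x (dec (Σ X (Bigger x)))

      step-⊆ : ∀ x → _⊆_ R (J x) (J (step x))
      step-⊆ x with dec (Σ X (Bigger x))
      ... | yes (_ , J⊆ , _) = J⊆
      ... | no _ = λ _ z∈ → z∈

      chain : ℕ → X
      chain = fold x₀ step

      chain-mono : ∀ {i k} → i ≤ k → _⊆_ R (J (chain i)) (J (chain k))
      chain-mono i≤k = mono (ℕ.≤⇒≤′ i≤k)
        where
        mono : ∀ {i k} → i ℕ.≤′ k → _⊆_ R (J (chain i)) (J (chain k))
        mono ℕ.≤′-refl _ x∈ = x∈
        mono {k = suc k} (ℕ.≤′-step i≤k) x x∈ = step-⊆ (chain k) x (mono i≤k x x∈)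

      union : Ideal R
      union = record
        { _∈I = λ x → Σ[ k ∈ ℕ ] _∈_ R x (J (chain k))
        ; resp = λ x≈y (k , p) → k , resp (J (chain k)) x≈y p
        ; zero∈ = 0 , zero∈ (J x₀)
        ; +-closed = λ (k , p) (l , q) → k ℕ.+ l , +-closed (J (chain (k ℕ.+ l)))
            (chain-mono (ℕ.m≤m+n k l) _ p) (chain-mono (ℕ.m≤n+m l k) _ q)
        ; *-closed = λ r (k , p) → k , *-closed (J (chain k)) r p
        }

      bounded : ∀ {gs} → All (λ g → _∈_ R g union) gs → Σ[ N ∈ ℕ ] All (λ g → _∈_ R g (J (chain N))) gs
      bounded [] = 0 , []
      bounded ((k , g∈) ∷ gs∈) with bounded gs∈
      ... | N , all = k ℕ.+ N , chain-mono (ℕ.m≤m+n k N) _ g∈ ∷ All.map (chain-mono (ℕ.m≤n+m N k) _) all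

      stable : Σ[ N ∈ ℕ ] _⊆_ R union (J (chain N))
      stable with bounded (generators∈ union (noeth union))
      ... | N , gs∈ = N , λ x x∈ → InSpan⇒∈ (J (chain N)) gs∈ (proj₁ (proj₂ (noeth union) x) x∈)

      stuck : ∀ x → _⊆_ R (J (step x)) (J x) → ∀ y → _⊆_ R (J x) (J y) → _⊆_ R (J y) (J x)
      stuck x step⊆ y x⊆y r r∈y with dec (Σ X (Bigger x)) | dec (_∈_ R r (J x))
      ... | _ | yes r∈x = r∈x
      ... | no ¬bigger | no r∉x = ⊥-elim (¬bigger (y , x⊆y , r , r∈y , r∉x))
      ... | yes (_ , _ , s , s∈ , s∉x) | no _ = ⊥-elim (s∉x (step⊆ s s∈))

    -- An ascending chain that grows whenever it can must stop, as its union is finitely generated.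
    -- The family is indexed by a small type because `dec` acts at level c ⊔ ℓ, one below `Ideal`.
    maximal : ∀ {X : Set (c ⊔ ℓ)} (J : X → Ideal R) (x₀ : X) →
      Σ[ x ∈ X ] _⊆_ R (J x₀) (J x) × (∀ y → _⊆_ R (J x) (J y) → _⊆_ R (J y) (J x))
    maximal J x₀ with stable
      where open Ascend J x₀
    ... | N , ∪⊆ = chain N , chain-mono {0} {N} ℕ.z≤n , stuck (chain N) (λ x x∈ → ∪⊆ x (suc N , x∈))
      where open Ascend J x₀

    -- The candidates are the ideals J + (gs), encoded by the lists gs to stay at the level of
    -- `dec`. For x outside a maximal one, 1 lies in P + (x), which is an inverse of x modulo P.
    properMaximal : ∀ J → IsProper R J → Σ[ P ∈ Ideal R ] _⊆_ R J P × IsProper R P ×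
      (∀ x → ¬ (_∈_ R x P) → Σ[ r ∈ Carrier ] _≡[_]_ R 1# P (r * x))
    properMaximal J 1∉J with maximal {X = Σ (List Carrier) (IsProper R ∘ extend)} (extend ∘ proj₁) ([] , 1∉J)
      where
      extend : List Carrier → Ideal R
      extend = foldr (λ x K → adjoin K x) J
    ... | (gs , 1∉P) , J⊆P , max = P , J⊆P , 1∉P , invertible
      where
      P : Ideal R
      P = foldr (λ x K → adjoin K x) J gs
      invertible : ∀ x → ¬ (_∈_ R x P) → Σ[ r ∈ Carrier ] _≡[_]_ R 1# P (r * x)
      invertible x x∉P with dec (_∈_ R 1# (adjoin P x))
      ... | yes 1∈ = 1∈
      ... | no 1∉ = ⊥-elim (x∉P (max (x ∷ gs , 1∉) (⊆-adjoin P x) x (∈-adjoin P x)))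

  invertible⇒prime : (dec : (A : Set (c ⊔ ℓ)) → Dec A) → ∀ P → IsProper R P →
    (∀ x → ¬ (_∈_ R x P) → Σ[ r ∈ Carrier ] _≡[_]_ R 1# P (r * x)) → IsPrime R P
  invertible⇒prime dec P 1∉P invertible = 1∉P , split
    where
    split : ∀ x y → _∈_ R (x * y) P → _∈_ R x P ⊎ _∈_ R y P
    split x y xy∈P with dec (_∈_ R x P)
    ... | yes x∈P = inj₁ x∈P
    ... | no x∉P with invertible x x∉P
    ...   | r , 1-rx∈P = inj₂ (resp P
            (solve 3 (λ r x y → y :* (con (+ 1) :- r :* x) :+ r :* (x :* y) := y) refl r x y)
            (+-closed P (*-closed P y 1-rx∈P) (*-closed P r xy∈P)))

-- Homogenised monic polynomials.

module Homogeneous {c ℓ : Level} (R : CommutativeRing c ℓ) where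
  open CommutativeRing R hiding (zero)
  open IntegerSolver R
  open import Relation.Binary.Reasoning.Setoid setoid

  -- The local function of homMonic cannot be named; it is recovered here by
  -- unification, the with-abstraction making its arguments distinct variables.
  mutual
    monicTail : Carrier → Carrier → List Carrier → ℕ → List Carrier → Carrier
    monicTail = _

    homMonic-∷ : ∀ a b d ds → homMonic R a b (d ∷ ds) ≡
      pow R a (suc (length ds)) +
        (d * pow R a 0 * pow R b (suc (length ds)) + monicTail a b (d ∷ ds) 1 ds)
    homMonic-∷ a b d ds with ds | 1 | d ∷ ds
    ... | es | i | full = ≡.refl

  form : Carrier → Carrier → ℕ → ℕ → List Carrier → Carrier
  form a b n i [] = 0#
  form a b n i (d ∷ ds) = d * pow R a i * pow R b (n ∸ i) + form a b n (suc i) ds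

  monicTail≡form : ∀ a b full i ds → monicTail a b full i ds ≡ form a b (length full) i ds
  monicTail≡form a b full i [] = ≡.refl
  monicTail≡form a b full i (d ∷ ds) = ≡.cong (λ t → d * pow R a i * pow R b (length full ∸ i) + t)
    (monicTail≡form a b full (suc i) ds)

  homMonic≡form : ∀ a b cs → homMonic R a b cs ≡ pow R a (length cs) + form a b (length cs) 0 cs
  homMonic≡form a b [] = ≡.refl
  homMonic≡form a b (d ∷ ds) = ≡.cong (λ t → pow R a (suc (length ds)) + (d * pow R a 0 * pow R b (suc (length ds)) + t))
    (monicTail≡form a b (d ∷ ds) 1 ds)

  form-∷ʳ : ∀ a b n i ds d →
    form a b n i (ds ∷ʳ d) ≈ form a b n i ds + d * pow R a (i ℕ.+ length ds) * pow R b (n ∸ (i ℕ.+ length ds))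
  form-∷ʳ a b n i [] d rewrite ℕ.+-identityʳ i = trans (+-identityʳ _) (sym (+-identityˡ _))
  form-∷ʳ a b n i (e ∷ ds) d rewrite ℕ.+-suc i (length ds) =
    trans (+-congˡ (form-∷ʳ a b n (suc i) ds d)) (sym (+-assoc _ _ _))

  -- Raising the degree adds one factor b to every term; the bound keeps the truncated subtraction
  -- in the exponents exact.
  form-suc : ∀ a b n i ds → i ℕ.+ length ds ≤ n → form a b (suc n) i ds ≈ b * form a b n i ds
  form-suc a b n i [] le = sym (zeroʳ b)
  form-suc a b n i (d ∷ ds) le rewrite ℕ.+-suc i (length ds) = begin
    d * pow R a i * pow R b (suc n ∸ i) + form a b (suc n) (suc i) ds
      ≡⟨ ≡.cong (λ k → d * pow R a i * pow R b k + form a b (suc n) (suc i) ds)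
           (ℕ.+-∸-assoc 1 (ℕ.≤-trans (ℕ.m≤m+n i _) (ℕ.<⇒≤ le))) ⟩
    d * pow R a i * (b * pow R b (n ∸ i)) + form a b (suc n) (suc i) ds
      ≈⟨ +-congˡ (form-suc a b n (suc i) ds le) ⟩
    d * pow R a i * (b * pow R b (n ∸ i)) + b * form a b n (suc i) ds
      ≈⟨ solve 5 (λ d p b q f → d :* p :* (b :* q) :+ b :* f := b :* (d :* p :* q :+ f)) refl _ _ _ _ _ ⟩
    b * (d * pow R a i * pow R b (n ∸ i) + form a b n (suc i) ds) ∎

-- Nonzero primes of a Dedekind domain are invertible: to contain is to divide.

module Divisibility {c ℓ : Level} (R : CommutativeRing c ℓ)
  (dec : (A : Set (c ⊔ ℓ)) → Dec A) (dedekind : IsDedekindDomain R) where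
  open CommutativeRing R hiding (zero)
  open IntegerSolver R
  open IdealTheory R
  open Homogeneous R
  open import Relation.Binary.Reasoning.Setoid setoid

  private
    nontrivial = proj₁ (proj₁ dedekind)
    noZeroDivisors = proj₂ (proj₁ dedekind)
    noeth = proj₁ (proj₂ dedekind)
    closed = proj₁ (proj₂ (proj₂ dedekind))
    dim≤1 = proj₂ (proj₂ (proj₂ dedekind))

  open Noetherian dec noeth

  *-cancelˡ : ∀ {a x y} → ¬ (a ≈ 0#) → a * x ≈ a * y → x ≈ y
  *-cancelˡ {a} {x} {y} a≉0 e with noZeroDivisors a (x - y)
    (trans (solve 3 (λ a x y → a :* (x :- y) := a :* x :- a :* y) refl a x y)
      (trans (+-congʳ e) (-‿inverseʳ (a * y))))
  ... | inj₁ a≈0 = ⊥-elim (a≉0 a≈0)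
  ... | inj₂ x-y≈0 = begin
    x             ≈⟨ solve 2 (λ x y → x := (x :- y) :+ y) refl x y ⟩
    (x - y) + y   ≈⟨ +-congʳ x-y≈0 ⟩
    0# + y        ≈⟨ +-identityˡ y ⟩
    y             ∎

  -- the ideal (a : x)
  colon : Carrier → Carrier → Ideal R
  colon a x = record
    { _∈I = λ r → Σ[ t ∈ Carrier ] r * x ≈ t * a
    ; resp = λ e ((t , p)) → (t , trans (*-congʳ (sym e)) p)
    ; zero∈ = (0# , trans (zeroˡ x) (sym (zeroˡ a)))
    ; +-closed = λ {r} {s} ((t , p)) ((u , q)) → (t + u ,
        trans (distribʳ x r s) (trans (+-cong p q) (sym (distribʳ a t u))))
    ; *-closed = λ s {r} ((t , p)) → (s * t ,
        trans (*-assoc s r x) (trans (*-congˡ p) (sym (*-assoc s t a))))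
    }

  module _ (P : Ideal R) (prime : IsPrime R P) {a : Carrier} (a∈P : _∈_ R a P) (a≉0 : ¬ (a ≈ 0#)) where

    -- Among the x with (a : x) ⊆ P take one with (a : x) maximal.
    colon-eq-prime : Σ[ b ∈ Carrier ] IsProper R (colon a b) × _⊆_ R P (colon a b)
    colon-eq-prime with maximal {X = Σ[ x ∈ Carrier ] _⊆_ R (colon a x) P} (colon a ∘ proj₁) (1# , colon-1)
      where
      colon-1 : _⊆_ R (colon a 1#) P
      colon-1 r ((t , p)) = resp P (trans (sym p) (*-identityʳ r)) (*-closed P t a∈P)
    ... | (b , L⊆P) , _ , max = b , proper , P⊆L
      where
      proper : IsProper R (colon a b)
      proper 1∈ = proj₁ prime (L⊆P 1# 1∈)
      -- For s outside `P`, primality keeps (a : s b) inside `P`, and it contains (a : b), so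
      -- maximality makes the two equal.
      scaled : ∀ {s} → ¬ (_∈_ R s P) → _⊆_ R (colon a (s * b)) (colon a b)
      scaled {s} s∉P = max (s * b , sub) λ r ((t , p)) → (s * t ,
          (begin
            r * (s * b) ≈⟨ solve 3 (λ r s b → r :* (s :* b) := s :* (r :* b)) refl r s b ⟩
            s * (r * b) ≈⟨ *-congˡ p ⟩
            s * (t * a) ≈⟨ *-assoc s t a ⟨
            s * t * a ∎))
        where
        sub : _⊆_ R (colon a (s * b)) P
        sub r ((t , p)) with proj₂ prime r s (L⊆P (r * s) ((t , trans (*-assoc r s b) p)))
        ... | inj₁ r∈P = r∈P
        ... | inj₂ s∈P = ⊥-elim (s∉P s∈P)
      -- Suppose r t b is in (a). If (a : t b) lies in `P`, maximality puts r in (a : b). Otherwise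
      -- s t b is in (a) for some s outside `P`, and `scaled` puts t there.
      L-prime : IsPrime R (colon a b)
      L-prime = proper , λ r t ((u , rt)) → split r t u rt
        where
        split : ∀ r t u → r * t * b ≈ u * a → _∈_ R r (colon a b) ⊎ _∈_ R t (colon a b)
        split r t u rt with dec (_∈_ R t (colon a b)) | dec (_⊆_ R (colon a (t * b)) P)
        ... | yes t∈ | _ = inj₂ t∈
        ... | no _ | yes sub = inj₁ (max (t * b , sub)
              (λ s ((v , p)) → (t * v ,
                (begin
                  s * (t * b) ≈⟨ solve 3 (λ s t b → s :* (t :* b) := t :* (s :* b)) refl s t b ⟩
                  t * (s * b) ≈⟨ *-congˡ p ⟩
                  t * (v * a) ≈⟨ *-assoc t v a ⟨
                  t * v * a ∎)))
              r ((u , trans (sym (*-assoc r t b)) rt)))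
        ... | no t∉ | no ¬sub with dec (Σ[ s ∈ Carrier ] _∈_ R s (colon a (t * b)) × ¬ (_∈_ R s P))
        ...   | yes (s , (v , p) , s∉P) = inj₂ (scaled s∉P t ((v ,
                  (begin
                    t * (s * b) ≈⟨ solve 3 (λ s t b → t :* (s :* b) := s :* (t :* b)) refl s t b ⟩
                    s * (t * b) ≈⟨ p ⟩
                    v * a ∎))))
        ...   | no none = ⊥-elim (¬sub λ s s∈ → decide s s∈ (dec (_∈_ R s P)))
          where
          decide : ∀ s → _∈_ R s (colon a (t * b)) → Dec (_∈_ R s P) → _∈_ R s P
          decide s s∈ (yes s∈P) = s∈P
          decide s s∈ (no s∉P) = ⊥-elim (none (s , s∈ , s∉P))
      -- The prime (a : b) contains `a`, so it is nonzero and therefore maximal, and it lies in the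
      -- proper ideal `P`.
      P⊆L : _⊆_ R P (colon a b)
      P⊆L with proj₂ (dim≤1 (colon a b) L-prime (a , (b , *-comm a b) , a≉0)) P L⊆P
      ... | inj₁ sub = sub
      ... | inj₂ 1∈P = ⊥-elim (proj₁ prime 1∈P)

    -- If b P ⊆ a P then a (b/a)^k ∈ P for all k, so by the ascending chain
    -- condition b/a is integral.
    module Integral (b : Carrier)
      (stay : ∀ p → _∈_ R p P → Σ[ r ∈ Carrier ] _∈_ R r P × p * b ≈ r * a) where

      seq : ℕ → Σ[ p ∈ Carrier ] _∈_ R p P
      seq zero = a , a∈P
      seq (suc k) = proj₁ (stay _ (proj₂ (seq k))) , proj₁ (proj₂ (stay _ (proj₂ (seq k))))

      p : ℕ → Carrier
      p k = proj₁ (seq k)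

      p-suc : ∀ k → p k * b ≈ p (suc k) * a
      p-suc k = proj₂ (proj₂ (stay _ (proj₂ (seq k))))

      p-pow : ∀ k → p k * pow R a k ≈ a * pow R b k
      p-pow zero = refl
      p-pow (suc k) = begin
        p (suc k) * (a * pow R a k) ≈⟨ *-assoc _ _ _ ⟨
        p (suc k) * a * pow R a k   ≈⟨ *-congʳ (p-suc k) ⟨
        p k * b * pow R a k         ≈⟨ solve 3 (λ x y z → x :* y :* z := y :* (x :* z)) refl _ _ _ ⟩
        b * (p k * pow R a k)       ≈⟨ *-congˡ (p-pow k) ⟩
        b * (a * pow R b k)         ≈⟨ solve 3 (λ x y z → x :* (y :* z) := y :* (x :* z)) refl _ _ _ ⟩
        a * (b * pow R b k)         ∎

      spanned : ℕ → Ideal R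
      spanned zero = zeroIdeal
      spanned (suc k) = adjoin (spanned k) (p k)

      -- Write x as a sum of multiples of p 0, ..., p (N - 1) and multiply by a^N: each p i becomes
      -- a b^i a^(N-i). The list holds the negated coefficients.
      relation : ∀ N x → _∈_ R x (spanned N) → Σ[ ds ∈ List Carrier ] length ds ≡ N ×
        x * pow R a N + a * form b a N 0 ds ≈ 0#
      relation zero x (lift x≈0) = [] , ≡.refl , (begin
        x * 1# + a * 0#   ≈⟨ +-congʳ (*-congʳ x≈0) ⟩
        0# * 1# + a * 0#  ≈⟨ solve 1 (λ a → con (+ 0) :* con (+ 1) :+ a :* con (+ 0) := con (+ 0)) refl a ⟩
        0#                ∎)
      relation (suc N) x (r , y∈) with relation N _ y∈
      ... | ds , ≡.refl , rel = ds ∷ʳ - r , ≡.trans (length-++ ds) (ℕ.+-comm _ 1) , (begin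
        x * (a * A) + a * form b a (suc N) 0 (ds ∷ʳ - r)
          ≈⟨ +-congˡ (*-congˡ (form-∷ʳ b a (suc N) 0 ds (- r))) ⟩
        x * (a * A) + a * (form b a (suc N) 0 ds + - r * B * pow R a (suc N ∸ N))
          ≡⟨ ≡.cong (λ k → x * (a * A) + a * (form b a (suc N) 0 ds + - r * B * pow R a k)) (ℕ.m+n∸n≡m 1 N) ⟩
        x * (a * A) + a * (form b a (suc N) 0 ds + - r * B * (a * 1#))
          ≈⟨ +-congˡ (*-congˡ (+-congʳ (form-suc b a N 0 ds ℕ.≤-refl))) ⟩
        x * (a * A) + a * (a * F + - r * B * (a * 1#))
          ≈⟨ solve 6 (λ x a A F r B → x :* (a :* A) :+ a :* (a :* F :+ (:- r) :* B :* (a :* con (+ 1)))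
               := a :* (x :* A :+ a :* F :- r :* (a :* B))) refl x a A F r B ⟩
        a * (x * A + a * F - r * (a * B))
          ≈⟨ *-congˡ (+-congˡ (-‿cong (*-congˡ (p-pow N)))) ⟨
        a * (x * A + a * F - r * (p N * A))
          ≈⟨ solve 6 (λ x a A F r q → a :* (x :* A :+ a :* F :- r :* (q :* A))
               := a :* ((x :- r :* q) :* A :+ a :* F)) refl x a A F r (p N) ⟩
        a * ((x - r * p N) * A + a * F)
          ≈⟨ *-congˡ rel ⟩
        a * 0#
          ≈⟨ zeroʳ a ⟩
        0# ∎)
        where
        A B F : Carrier
        A = pow R a N
        B = pow R b N
        F = form b a N 0 ds

      integral : Σ[ cs ∈ List Carrier ] homMonic R b a cs ≈ 0#
      integral with maximal {X = Lift _ ℕ} (spanned ∘ lower) (lift 0)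
      -- Comparison with the index N + 1 puts `p N` into the span of its predecessors, and the
      -- relation for `p N` is the integral equation times `a`.
      ... | lift N , _ , max
        with relation N (p N) (max (lift (suc N)) (⊆-adjoin (spanned N) (p N)) _ (∈-adjoin (spanned N) (p N)))
      ... | cs , ≡.refl , rel = cs , *-cancelˡ a≉0 (begin
        a * homMonic R b a cs                         ≡⟨ ≡.cong (a *_) (homMonic≡form b a cs) ⟩
        a * (pow R b N + form b a N 0 cs)             ≈⟨ distribˡ a _ _ ⟩
        a * pow R b N + a * form b a N 0 cs           ≈⟨ +-congʳ (p-pow N) ⟨
        p N * pow R a N + a * form b a N 0 cs         ≈⟨ rel ⟩
        0#                                            ≈⟨ zeroʳ a ⟨
        a * 0#                                        ∎)

      quotient∈R : Σ[ r ∈ Carrier ] b ≈ r * a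
      quotient∈R = closed b a (proj₁ integral) a≉0 (proj₂ integral)

    -- Otherwise b/a maps `P` into itself, is integral and lies in R, so 1 belongs to (a : b).
    escape : ∀ {b} → IsProper R (colon a b) → _⊆_ R P (colon a b) →
      Σ[ p ∈ Carrier ] Σ[ r ∈ Carrier ] _∈_ R p P × ¬ (_∈_ R r P) × p * b ≈ r * a
    escape {b} proper P⊆ with dec (Σ[ p ∈ Carrier ] Σ[ r ∈ Carrier ] _∈_ R p P × ¬ (_∈_ R r P) × p * b ≈ r * a)
    ... | yes found = found
    ... | no none = ⊥-elim (proper ((proj₁ div , trans (*-identityˡ b) (proj₂ div))))
      where
      stay : ∀ p → _∈_ R p P → Σ[ r ∈ Carrier ] _∈_ R r P × p * b ≈ r * a
      stay p p∈P with P⊆ p p∈P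
      ... | (r , e) with dec (_∈_ R r P)
      ...   | yes r∈P = r , r∈P , e
      ...   | no r∉P = ⊥-elim (none (p , r , p∈P , r∉P , e))
      div = Integral.quotient∈R b stay

    -- With bP ⊆ (a), p b = r a, p ∈ P and s r ≡ 1 mod P, the fractional ideal
    -- generated by 1 and b/a is inverse to P; the cofactor is its product with I.
    ∣ᴵ-of-⊆ : (∀ x → ¬ (_∈_ R x P) → Σ[ r ∈ Carrier ] _≡[_]_ R 1# P (r * x)) →
      (I : Ideal R) → _⊆_ R I P → _∣ᴵ_ R P I
    ∣ᴵ-of-⊆ invertible I I⊆P with colon-eq-prime
    ... | b , proper , P⊆ with escape proper P⊆
    ... | p , r , p∈P , r∉P , pb≈ra with invertible r r∉P
    ... | s , 1-sr∈P = J , λ x → into x , out x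
      where
      J : Ideal R
      J = record
        -- The condition is y = u + (b/a) v with u and v in `I`.
        { _∈I = λ y → Σ[ u ∈ Carrier ] Σ[ v ∈ Carrier ] _∈_ R u I × _∈_ R v I × a * y ≈ a * u + b * v
        ; resp = λ e (u , v , u∈ , v∈ , eq) → u , v , u∈ , v∈ , trans (*-congˡ (sym e)) eq
        ; zero∈ = 0# , 0# , zero∈ I , zero∈ I ,
            solve 2 (λ a b → a :* con (+ 0) := a :* con (+ 0) :+ b :* con (+ 0)) refl a b
        ; +-closed = λ {y} {z} (u , v , u∈ , v∈ , e) (u′ , v′ , u′∈ , v′∈ , e′) →
            u + u′ , v + v′ , +-closed I u∈ u′∈ , +-closed I v∈ v′∈ , (begin
              a * (y + z)                              ≈⟨ distribˡ a y z ⟩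
              a * y + a * z                            ≈⟨ +-cong e e′ ⟩
              (a * u + b * v) + (a * u′ + b * v′)      ≈⟨ solve 6 (λ a b u v u′ v′ →
                (a :* u :+ b :* v) :+ (a :* u′ :+ b :* v′) := a :* (u :+ u′) :+ b :* (v :+ v′)) refl a b u v u′ v′ ⟩
              a * (u + u′) + b * (v + v′)              ∎)
        ; *-closed = λ t {y} (u , v , u∈ , v∈ , e) →
            t * u , t * v , *-closed I t u∈ , *-closed I t v∈ , (begin
              a * (t * y)                  ≈⟨ solve 3 (λ a t y → a :* (t :* y) := t :* (a :* y)) refl a t y ⟩
              t * (a * y)                  ≈⟨ *-congˡ e ⟩
              t * (a * u + b * v)          ≈⟨ solve 5 (λ a b t u v →
                t :* (a :* u :+ b :* v) := a :* (t :* u) :+ b :* (t :* v)) refl a b t u v ⟩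
              a * (t * u) + b * (t * v)    ∎)
        }
      into : ∀ x → _∈_ R x I → InProduct R P J x
      into x x∈I with P⊆ x (I⊆P x x∈I)
      -- With r = p b/a and x′ = x b/a, the splitting x = s r x + (1 - s r) x reads p (s x′) + (1 -
      -- s r) x, and both p and 1 - s r lie in `P`.
      ... | (x′ , xb≈x′a) = (p , s * x′) ∷ (1# - s * r , x) ∷ [] ,
            (p∈P , *-closed J s x′∈J) ∷ (1-sr∈P , x∈J) ∷ [] , *-cancelˡ a≉0 (begin
              a * x
                ≈⟨ solve 4 (λ a x s r → a :* x := s :* x :* (r :* a) :+ a :* ((con (+ 1) :- s :* r) :* x)) refl a x s r ⟩
              s * x * (r * a) + a * ((1# - s * r) * x)
                ≈⟨ +-congʳ (*-congˡ pb≈ra) ⟨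
              s * x * (p * b) + a * ((1# - s * r) * x)
                ≈⟨ +-congʳ (solve 4 (λ s x p b → s :* x :* (p :* b) := p :* s :* (x :* b)) refl s x p b) ⟩
              p * s * (x * b) + a * ((1# - s * r) * x)
                ≈⟨ +-congʳ (*-congˡ xb≈x′a) ⟩
              p * s * (x′ * a) + a * ((1# - s * r) * x)
                ≈⟨ solve 6 (λ a x s r p x′ → p :* s :* (x′ :* a) :+ a :* ((con (+ 1) :- s :* r) :* x)
                     := a :* (p :* (s :* x′) :+ ((con (+ 1) :- s :* r) :* x :+ con (+ 0)))) refl a x s r p x′ ⟩
              a * (p * (s * x′) + ((1# - s * r) * x + 0#)) ∎)
        where
        x∈J : _∈_ R x J
        x∈J = x , 0# , x∈I , zero∈ I , solve 3 (λ a b x → a :* x := a :* x :+ b :* con (+ 0)) refl a b x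
        x′∈J : _∈_ R x′ J
        x′∈J = 0# , x , zero∈ I , x∈I , (begin
          a * x′           ≈⟨ *-comm a x′ ⟩
          x′ * a           ≈⟨ xb≈x′a ⟨
          x * b            ≈⟨ solve 3 (λ a b x → x :* b := a :* con (+ 0) :+ b :* x) refl a b x ⟩
          a * 0# + b * x   ∎)
      out : ∀ x → InProduct R P J x → _∈_ R x I
      out x (ps , ps∈ , x≈) = resp I (sym x≈) (sumProd∈ ps ps∈)
        where
        sumProd∈ : ∀ ps → All (λ pr → _∈_ R (proj₁ pr) P × _∈_ R (proj₂ pr) J) ps → _∈_ R (sumProd R ps) I
        sumProd∈ [] [] = zero∈ I
        sumProd∈ ((q , y) ∷ ps) ((q∈P , u , v , u∈ , v∈ , e) ∷ ps∈) with P⊆ q q∈P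
        -- For q in `P` the fraction q′ = q b/a lies in R, so q y = q u + q′ v is in `I`.
        ... | (q′ , qb≈q′a) = +-closed I
              (resp I (sym (*-cancelˡ a≉0 (begin
                a * (q * y)              ≈⟨ solve 3 (λ a q y → a :* (q :* y) := q :* (a :* y)) refl a q y ⟩
                q * (a * y)              ≈⟨ *-congˡ e ⟩
                q * (a * u + b * v)      ≈⟨ solve 5 (λ q a u b v → q :* (a :* u :+ b :* v) := a :* (q :* u) :+ v :* (q :* b)) refl q a u b v ⟩
                a * (q * u) + v * (q * b)  ≈⟨ +-congˡ (*-congˡ qb≈q′a) ⟩
                a * (q * u) + v * (q′ * a) ≈⟨ solve 5 (λ q a u q′ v → a :* (q :* u) :+ v :* (q′ :* a) := a :* (q :* u :+ q′ :* v)) refl q a u q′ v ⟩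
                a * (q * u + q′ * v)     ∎)))
                (+-closed I (*-closed I q u∈) (*-closed I q′ v∈)))
              (sumProd∈ ps ps∈)

-- The additive order of 1 in a finite ring.

module Characteristic {c ℓ : Level} (A : CommutativeRing c ℓ) where
  open CommutativeRing A hiding (zero)
  open IntegerSolver A
  open Algebra.Properties.CommutativeMonoid.Sum +-commutativeMonoid
  open Algebra.Properties.Semiring.Mult semiring using (×1-homo-*) renaming (_×_ to _·_)
  open import Relation.Binary.Reasoning.Setoid setoid

  -- Translation by 1 permutes the ring, so it does not change the sum of all elements.
  card·1≈0 : ∀ {n} (u : Fin n → Carrier) → (∀ i j → u i ≈ u j → i ≡ j) →
    (∀ x → Σ[ i ∈ Fin n ] x ≈ u i) → n · 1# ≈ 0#
  card·1≈0 {n} u u-inj u-surj = sym (Algebra.Properties.Group.∙-cancelˡ +-group (sum u) 0# (n · 1#) (begin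
      sum u + 0#                    ≈⟨ +-identityʳ (sum u) ⟩
      sum u                         ≈⟨ sum-permute u (permutation up down up-down down-up) ⟩
      sum (u ∘ up)                  ≈⟨ sum-cong-≋ (λ i → u-index (u i + 1#)) ⟩
      sum (λ i → u i + 1#)          ≈⟨ ∑-distrib-+ u (λ _ → 1#) ⟩
      sum u + sum {n} (λ _ → 1#)    ≈⟨ +-congˡ (sum-replicate n) ⟩
      sum u + n · 1#                ∎))
    where
    index : Carrier → Fin n
    index x = proj₁ (u-surj x)
    u-index : ∀ x → u (index x) ≈ x
    u-index x = sym (proj₂ (u-surj x))
    up down : Fin n → Fin n
    up i = index (u i + 1#)
    down i = index (u i - 1#)
    up-down : ∀ i → up (down i) ≡ i
    up-down i = u-inj _ _ (begin
      u (up (down i))   ≈⟨ u-index _ ⟩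
      u (down i) + 1#   ≈⟨ +-congʳ (u-index _) ⟩
      u i - 1# + 1#     ≈⟨ solve 1 (λ x → x :- con (+ 1) :+ con (+ 1) := x) refl (u i) ⟩
      u i               ∎)
    down-up : ∀ i → down (up i) ≡ i
    down-up i = u-inj _ _ (begin
      u (down (up i))   ≈⟨ u-index _ ⟩
      u (up i) - 1#     ≈⟨ +-congʳ (u-index _) ⟩
      u i + 1# - 1#     ≈⟨ solve 1 (λ x → x :+ con (+ 1) :- con (+ 1) := x) refl (u i) ⟩
      u i               ∎)

  pow2≈0⇒2≈0 : ¬ (1# ≈ 0#) → (∀ x y → x * y ≈ 0# → x ≈ 0# ⊎ y ≈ 0#) →
    ∀ e → (2 ^ e) · 1# ≈ 0# → 1# + 1# ≈ 0#
  pow2≈0⇒2≈0 1≉0 domain zero eq = ⊥-elim (1≉0 (trans (sym (+-identityʳ 1#)) eq))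
  pow2≈0⇒2≈0 1≉0 domain (suc e) eq with domain (2 · 1#) ((2 ^ e) · 1#) (trans (sym (×1-homo-* 2 (2 ^ e))) eq)
  ... | inj₁ 2≈0 = trans (+-congˡ (sym (+-identityʳ 1#))) 2≈0
  ... | inj₂ 2^e≈0 = pow2≈0⇒2≈0 1≉0 domain e 2^e≈0

-- Residue rings in which 2 vanishes, as vector spaces over the field of two elements.

module ResidueRing {c ℓ : Level} (R : CommutativeRing c ℓ) where
  open CommutativeRing R hiding (zero)
  open IntegerSolver R
  open IdealTheory R

  two : Carrier
  two = 1# + 1#

  pow2-card⇒two∈ : ∀ P → IsPrime R P → ∀ e → QuotientCard R P (2 ^ e) → _∈_ R two P
  pow2-card⇒two∈ P (1∉P , prime) e (u , _ , u-inj , u-surj) = ≈0⇒∈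
    (Characteristic.pow2≈0⇒2≈0 (quotient P) (1∉P ∘ ≈0⇒∈) domain e
      (Characteristic.card·1≈0 (quotient P) u u-inj (λ x → u-surj x _)))
    where
    ≈0⇒∈ : ∀ {x} → _≡[_]_ R x P 0# → _∈_ R x P
    ≈0⇒∈ {x} = resp P (solve 1 (λ x → x :- con (+ 0) := x) refl x)
    ∈⇒≈0 : ∀ {x} → _∈_ R x P → _≡[_]_ R x P 0#
    ∈⇒≈0 {x} = resp P (solve 1 (λ x → x := x :- con (+ 0)) refl x)
    domain : ∀ x y → _≡[_]_ R (x * y) P 0# → _≡[_]_ R x P 0# ⊎ _≡[_]_ R y P 0#
    domain x y xy∈ = [ inj₁ ∘ ∈⇒≈0 , inj₂ ∘ ∈⇒≈0 ]′ (prime x y (≈0⇒∈ xy∈))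

  module Elementary (dec : (A : Set (c ⊔ ℓ)) → Dec A) (P : Ideal R) (two∈P : _∈_ R two P) where

    record Subgroup : Set (Level.suc (c ⊔ ℓ)) where
      field
        mem : Carrier → Set (c ⊔ ℓ)
        mem-resp : ∀ {x y} → x ≈ y → mem x → mem y
        ⊇P : ∀ {x} → _∈_ R x P → mem x
        mem-+ : ∀ {x y} → mem x → mem y → mem (x + y)

      -- Modulo `P` every element is its own negative, since 2 is in `P`.
      mem-neg : ∀ {x} → mem x → mem (- x)
      mem-neg {x} x∈ = mem-resp (solve 1 (λ x → x :+ :- x :* (con (+ 1) :+ con (+ 1)) := :- x) refl x)
        (mem-+ x∈ (⊇P (*-closed P (- x) two∈P)))

      mem-∸ : ∀ {x y} → mem x → mem y → mem (x - y)
      mem-∸ x∈ y∈ = mem-+ x∈ (mem-neg y∈)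

      mem-mod : ∀ {x y} → _≡[_]_ R x P y → mem x → mem y
      mem-mod {x} {y} x≡y x∈ = mem-resp (solve 2 (λ x y → x :- (x :- y) := y) refl x y) (mem-∸ x∈ (⊇P x≡y))

    open Subgroup

    base : Subgroup
    base = record { mem = λ x → _∈_ R x P ; mem-resp = resp P ; ⊇P = λ p → p ; mem-+ = +-closed P }

    -- The span of H and x: two cosets suffice because 2x is in `P`.
    extend : Subgroup → Carrier → Subgroup
    extend H x = record
      { mem = λ y → mem H y ⊎ mem H (y - x)
      ; mem-resp = λ { e (inj₁ p) → inj₁ (mem-resp H e p) ; e (inj₂ p) → inj₂ (mem-resp H (+-congʳ e) p) }
      ; ⊇P = inj₁ ∘ ⊇P H
      ; mem-+ = λ { {y} {z} → add y z }
      }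
      where
      add : ∀ y z → mem H y ⊎ mem H (y - x) → mem H z ⊎ mem H (z - x) → mem H (y + z) ⊎ mem H (y + z - x)
      add y z (inj₁ p) (inj₁ q) = inj₁ (mem-+ H p q)
      add y z (inj₁ p) (inj₂ q) = inj₂ (mem-resp H
        (solve 3 (λ x y z → y :+ (z :- x) := y :+ z :- x) refl x y z) (mem-+ H p q))
      add y z (inj₂ p) (inj₁ q) = inj₂ (mem-resp H
        (solve 3 (λ x y z → (y :- x) :+ z := y :+ z :- x) refl x y z) (mem-+ H p q))
      add y z (inj₂ p) (inj₂ q) = inj₁ (mem-resp H
        (solve 3 (λ x y z → (y :- x) :+ (z :- x) :+ x :* (con (+ 1) :+ con (+ 1)) := y :+ z) refl x y z)
        (mem-+ H (mem-+ H p q) (⊇P H (*-closed P x two∈P))))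

    ∈-extend : ∀ H x → mem (extend H x) x
    ∈-extend H x = inj₂ (⊇P H (resp P (sym (-‿inverseʳ x)) (zero∈ P)))

    -- A hyperplane avoiding 1, built greedily: x already lies in 1 + H when 1 - x is in H, and
    -- otherwise adjoining x keeps 1 out.
    index-two-on : IsProper R P → ∀ xs → Σ[ H ∈ Subgroup ] ¬ mem H 1# ×
      All (λ x → mem H x ⊎ mem H (1# - x)) xs
    index-two-on 1∉P [] = base , 1∉P , []
    index-two-on 1∉P (x ∷ xs) with index-two-on 1∉P xs
    ... | H , 1∉H , all with dec (mem H (1# - x))
    ...   | yes 1-x∈H = H , 1∉H , inj₂ 1-x∈H ∷ all
    ...   | no 1-x∉H = extend H x , [ 1∉H , 1-x∉H ]′ , inj₁ (∈-extend H x) ∷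
              All.map [ inj₁ ∘ inj₁ , inj₂ ∘ inj₁ ]′ all

    count-extend : ∀ H x → ¬ mem H x → ∀ {m} → CountMod R P (mem H) m → CountMod R P (mem (extend H x)) (m ℕ.+ m)
    count-extend H x x∉H {m} (u , u∈ , u-inj , u-surj) = v ∘ splitAt m , v∈ ∘ splitAt m , v-inj , v-surj
      where
      v : Fin m ⊎ Fin m → Carrier
      v = [ u , (λ i → u i + x) ]′
      v∈ : ∀ s → mem (extend H x) (v s)
      v∈ (inj₁ i) = inj₁ (u∈ i)
      v∈ (inj₂ i) = inj₂ (mem-resp H (solve 2 (λ a x → a := a :+ x :- x) refl (u i) x) (u∈ i))
      v-inj′ : ∀ s t → _≡[_]_ R (v s) P (v t) → s ≡ t
      v-inj′ (inj₁ i) (inj₁ j) e = ≡.cong inj₁ (u-inj i j e)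
      v-inj′ (inj₂ i) (inj₂ j) e = ≡.cong inj₂ (u-inj i j (resp P
        (solve 3 (λ a b x → (a :+ x) :- (b :+ x) := a :- b) refl (u i) (u j) x) e))
      v-inj′ (inj₁ i) (inj₂ j) e = ⊥-elim (x∉H (mem-resp H
        (solve 3 (λ a b x → (a :- b) :- (a :- (b :+ x)) := x) refl (u i) (u j) x)
        (mem-∸ H (mem-∸ H (u∈ i) (u∈ j)) (⊇P H e))))
      v-inj′ (inj₂ i) (inj₁ j) e = ⊥-elim (x∉H (mem-resp H
        (solve 3 (λ a b x → ((a :+ x) :- b) :- (a :- b) := x) refl (u i) (u j) x)
        (mem-∸ H (⊇P H e) (mem-∸ H (u∈ i) (u∈ j)))))
      v-inj : ∀ i j → _≡[_]_ R (v (splitAt m i)) P (v (splitAt m j)) → i ≡ j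
      v-inj i j e = ≡.trans (≡.sym (Fin.join-splitAt m m i))
        (≡.trans (≡.cong (Fin.join m m) (v-inj′ (splitAt m i) (splitAt m j) e)) (Fin.join-splitAt m m j))
      v-surj : ∀ y → mem (extend H x) y → Σ[ i ∈ Fin (m ℕ.+ m) ] _≡[_]_ R y P (v (splitAt m i))
      v-surj y (inj₁ y∈) with u-surj y y∈
      ... | i , e = i ↑ˡ m , ≡.subst (λ s → _≡[_]_ R y P (v s)) (≡.sym (Fin.splitAt-↑ˡ m i m)) e
      v-surj y (inj₂ y-x∈) with u-surj (y - x) y-x∈
      ... | i , e = m ↑ʳ i , ≡.subst (λ s → _≡[_]_ R y P (v s)) (≡.sym (Fin.splitAt-↑ʳ m m i))
            (resp P (solve 3 (λ a x y → (y :- x) :- a := y :- (a :+ x)) refl (u i) x y) e)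

    -- As in choosing a basis, each element outside the current subgroup doubles the number of
    -- classes, starting from the single class of 0.
    pow2-count-on : ∀ xs → Σ[ H ∈ Subgroup ] (Σ[ e ∈ ℕ ] CountMod R P (mem H) (2 ^ e)) × All (mem H) xs
    pow2-count-on [] = base , (0 , (λ _ → 0#) , (λ _ → zero∈ P) , (λ { zero zero _ → ≡.refl }) ,
      λ y y∈ → zero , resp P (solve 1 (λ y → y := y :- con (+ 0)) refl y) y∈) , []
    pow2-count-on (x ∷ xs) with pow2-count-on xs
    ... | H , (e , count) , all with dec (mem H x)
    ...   | yes x∈H = H , (e , count) , x∈H ∷ all
    ...   | no x∉H = extend H x ,
              -- The power 2 ^ suc e unfolds to 2^e + (2^e + 0), hence the transport.
              (suc e , ≡.subst (CountMod R P (mem (extend H x))) (≡.cong ((2 ^ e) ℕ.+_) (≡.sym (ℕ.+-identityʳ (2 ^ e))))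
                (count-extend H x x∉H count)) ,
              ∈-extend H x ∷ All.map inj₁ all

    -- Only coverage is asked of `u`, so that representatives of R/I can serve for R/P, where they
    -- may repeat.
    module _ {n} (u : Fin n → Carrier) (u-surj : ∀ x → Σ[ i ∈ Fin n ] _≡[_]_ R x P (u i)) where

      private
        sym-mod : ∀ {x y} → _≡[_]_ R x P y → _≡[_]_ R y P x
        sym-mod = CommutativeRing.sym (quotient P)

      index-two : IsProper R P → Σ[ H ∈ Subgroup ] ¬ mem H 1# × (∀ x → mem H x ⊎ mem H (1# - x))
      index-two 1∉P with index-two-on 1∉P (tabulate u)
      ... | H , 1∉H , all = H , 1∉H , λ x → either x (u-surj x)
        where
        either : ∀ x → Σ[ i ∈ Fin n ] _≡[_]_ R x P (u i) → mem H x ⊎ mem H (1# - x)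
        either x (i , x≡u) with All.tabulate⁻ all i
        ... | inj₁ u∈ = inj₁ (mem-mod H (sym-mod x≡u) u∈)
        ... | inj₂ 1-u∈ = inj₂ (mem-mod H (resp P
              (solve 2 (λ x u → x :- u := (con (+ 1) :- u) :- (con (+ 1) :- x)) refl x (u i)) x≡u) 1-u∈)

      card-pow2 : Σ[ e ∈ ℕ ] QuotientCard R P (2 ^ e)
      card-pow2 with pow2-count-on (tabulate u)
      ... | H , (e , v , _ , v-inj , v-surj) , all = e , v , _ , v-inj , λ x _ → v-surj x (all∈ x (u-surj x))
        where
        all∈ : ∀ x → Σ[ i ∈ Fin n ] _≡[_]_ R x P (u i) → mem H x
        all∈ x (i , x≡u) = mem-mod H (sym-mod x≡u) (All.tabulate⁻ all i)

-- Edge colourings of the unitary Cayley graph of a finite commutative ring.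

module Cayley {c ℓ : Level} (A : CommutativeRing c ℓ) where
  open EdgeColouringTheorem
  open Parity
  open CommutativeRing A hiding (zero)
  open IntegerSolver A
  open import Relation.Binary.Reasoning.Setoid setoid

  Unit : Carrier → Set (c ⊔ ℓ)
  Unit x = Σ[ y ∈ Carrier ] x * y ≈ 1#

  Adjacent : Carrier → Carrier → Set (c ⊔ ℓ)
  Adjacent a b = Unit (a - b)

  EdgeColouring : ℕ → Set (c ⊔ ℓ)
  EdgeColouring k = Σ ((a b : Carrier) → Adjacent a b → Fin k) λ col →
    (∀ a a′ b b′ p p′ → a ≈ a′ → b ≈ b′ → col a b p ≡ col a′ b′ p′) ×
    (∀ a b p q → col a b p ≡ col b a q) ×
    (∀ a b b′ p p′ → ¬ (b ≈ b′) → col a b p ≢ col a b′ p′)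

  Unit-resp : ∀ {x y} → x ≈ y → Unit x → Unit y
  Unit-resp x≈y (z , e) = z , trans (*-congʳ (sym x≈y)) e

  Unit-flip : ∀ {a b} → Adjacent a b → Adjacent b a
  Unit-flip {a} {b} (z , e) = - z , trans (solve 3 (λ a b z → (b :- a) :* :- z := (a :- b) :* z) refl a b z) e

  -- An adjacency proof carries an inverse of the difference; this makes tests on that inverse
  -- independent of the proof.
  inverse-unique : ∀ {x y s t} → x ≈ y → x * s ≈ 1# → y * t ≈ 1# → s ≈ t
  inverse-unique {x} {y} {s} {t} x≈y xs yt = begin
    s             ≈⟨ *-identityʳ s ⟨
    s * 1#        ≈⟨ *-congˡ yt ⟨
    s * (y * t)   ≈⟨ *-congˡ (*-congʳ x≈y) ⟨
    s * (x * t)   ≈⟨ solve 3 (λ x s t → s :* (x :* t) := (x :* s) :* t) refl x s t ⟩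
    (x * s) * t   ≈⟨ *-congʳ xs ⟩
    1# * t        ≈⟨ *-identityˡ t ⟩
    t             ∎

  minus-cancelˡ : ∀ {a x y} → a - x ≈ a - y → x ≈ y
  minus-cancelˡ {a} {x} {y} e = begin
    x            ≈⟨ solve 2 (λ a x → x := a :- (a :- x)) refl a x ⟩
    a - (a - x)  ≈⟨ +-congˡ (-‿cong e) ⟩
    a - (a - y)  ≈⟨ solve 2 (λ a x → a :- (a :- x) := x) refl a y ⟩
    y            ∎

  module UnitSystem {φ} (w : Fin φ → Carrier) (w-unit : ∀ i → Unit (w i)) (w-inj : ∀ i j → w i ≈ w j → i ≡ j)
           (w-surj : ∀ x → Unit x → Σ[ i ∈ Fin φ ] x ≈ w i) where

    unitIndex : ∀ x → Unit x → Fin φ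
    unitIndex x p = proj₁ (w-surj x p)

    unitIndex-cong : ∀ {x y} p q → x ≈ y → unitIndex x p ≡ unitIndex y q
    unitIndex-cong {x} {y} p q x≈y = w-inj _ _ (trans (sym (proj₂ (w-surj x p))) (trans x≈y (proj₂ (w-surj y q))))

    unitIndex-inj : ∀ {x y} p q → unitIndex x p ≡ unitIndex y q → x ≈ y
    unitIndex-inj {x} {y} p q e = trans (proj₂ (w-surj x p)) (trans (reflexive (≡.cong w e)) (sym (proj₂ (w-surj y q))))

    -- H is an additive subgroup of index two not containing 1. For an edge {a, b},
    -- exactly one of a, b lies in (a - b)H; the edge is coloured by the difference
    -- taken from that end.
    module IndexTwo {p} (H : Carrier → Set p) (H? : ∀ x → Dec (H x))
      (H-resp : ∀ {x y} → x ≈ y → H x → H y) (H-+ : ∀ {x y} → H x → H y → H (x + y)) (H-neg : ∀ {x} → H x → H (- x))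
      (1∉H : ¬ H 1#) (H-or : ∀ x → H x ⊎ H (1# - x)) where

      -- The difference of t a and t b is 1, which `H` misses.
      not-both : ∀ {a b} ((t , _) : Adjacent a b) → H (t * a) → ¬ H (t * b)
      not-both {a} {b} (t , e) ta tb = 1∉H (H-resp
        (trans (solve 3 (λ a b t → t :* a :+ :- (t :* b) := (a :- b) :* t) refl a b t) e) (H-+ ta (H-neg tb)))

      one-of : ∀ {a b} ((t , _) : Adjacent a b) → ¬ H (t * a) → H (t * b)
      one-of {a} {b} (t , e) ¬ta with H-or (t * a)
      ... | inj₁ ta = ⊥-elim (¬ta ta)
      ... | inj₂ 1-ta = H-resp (begin
        - (1# - t * a)            ≈⟨ -‿cong (+-congʳ e) ⟨
        - ((a - b) * t - t * a)   ≈⟨ solve 3 (λ a b t → :- ((a :- b) :* t :- t :* a) := t :* b) refl a b t ⟩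
        t * b                     ∎) (H-neg 1-ta)

      -- From its other end an edge has the negated difference and so the negated inverse, and `H`
      -- is closed under negation.
      opposite : ∀ {x y s t} → x ≈ - y → x * s ≈ 1# → y * t ≈ 1# → ∀ a → H (s * a) → H (t * a)
      opposite {x} {y} {s} {t} x≈-y xs yt a sa = H-resp
        (trans (sym (solve 2 (λ s a → (:- s) :* a := :- (s :* a)) refl s a)) (*-congʳ (inverse-unique -x≈y -x-s yt)))
        (H-neg sa)
        where
        -x≈y : - x ≈ y
        -x≈y = trans (-‿cong x≈-y) (solve 1 (λ y → :- (:- y) := y) refl y)
        -x-s : - x * - s ≈ 1#
        -x-s = trans (solve 2 (λ x s → :- x :* :- s := x :* s) refl x s) xs

      same : ∀ {x y s t} → x ≈ y → x * s ≈ 1# → y * t ≈ 1# → ∀ {a b} → a ≈ b → H (s * a) → H (t * b)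
      same x≈y xs yt a≈b = H-resp (*-cong (inverse-unique x≈y xs yt) a≈b)

      pick : ∀ {q} {B : Set q} a b → Adjacent a b → Dec B → Fin φ
      pick a b p (yes _) = unitIndex (a - b) p
      pick a b p (no _) = unitIndex (b - a) (Unit-flip p)

      colouring : EdgeColouring φ
      colouring = col , respects , symmetric , proper
        where
        col : ∀ a b → Adjacent a b → Fin φ
        col a b p = pick a b p (H? (proj₁ p * a))
        flip-minus : ∀ a b → a - b ≈ - (b - a)
        flip-minus = solve 2 (λ a b → a :- b := :- (b :- a)) refl
        respects : ∀ a a′ b b′ p p′ → a ≈ a′ → b ≈ b′ → col a b p ≡ col a′ b′ p′
        respects a a′ b b′ p p′ a≈ b≈ with H? (proj₁ p * a) | H? (proj₁ p′ * a′)
        ... | yes _ | yes _ = unitIndex-cong _ _ (+-cong a≈ (-‿cong b≈))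
        ... | no _ | no _ = unitIndex-cong _ _ (+-cong b≈ (-‿cong a≈))
        ... | yes h | no ¬h = ⊥-elim (¬h (same (+-cong a≈ (-‿cong b≈)) (proj₂ p) (proj₂ p′) a≈ h))
        ... | no ¬h | yes h = ⊥-elim (¬h (same (+-cong (sym a≈) (-‿cong (sym b≈))) (proj₂ p′) (proj₂ p) (sym a≈) h))
        symmetric : ∀ a b p q → col a b p ≡ col b a q
        symmetric a b p q with H? (proj₁ p * a) | H? (proj₁ q * b)
        ... | yes _ | no _ = unitIndex-cong _ _ refl
        ... | no _ | yes _ = unitIndex-cong _ _ refl
        ... | yes h | yes h′ = ⊥-elim (not-both p h (opposite (flip-minus b a) (proj₂ q) (proj₂ p) b h′))
        ... | no ¬h | no ¬h′ = ⊥-elim (¬h′ (opposite (flip-minus a b) (proj₂ p) (proj₂ q) b (one-of p ¬h)))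
        proper : ∀ a b b′ p p′ → ¬ (b ≈ b′) → col a b p ≢ col a b′ p′
        proper a b b′ p p′ b≉b′ e with H? (proj₁ p * a) | H? (proj₁ p′ * a)
        ... | yes _ | yes _ = b≉b′ (minus-cancelˡ (unitIndex-inj _ _ e))
        ... | no _ | no _ = b≉b′ (begin
                b              ≈⟨ solve 2 (λ a b → b := (b :- a) :+ a) refl a b ⟩
                (b - a) + a    ≈⟨ +-congʳ (unitIndex-inj _ _ e) ⟩
                (b′ - a) + a   ≈⟨ solve 2 (λ a b → (b :- a) :+ a := b) refl a b′ ⟩
                b′             ∎)
        -- Equal colours would give a - b = -(a - b′); then the tests at `a` for the two edges must
        -- agree, but they differ.
        ... | yes h | no ¬h = ¬h (opposite (trans (unitIndex-inj _ _ e) (flip-minus b′ a)) (proj₂ p) (proj₂ p′) a h)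
        ... | no ¬h | yes h = ¬h (opposite (trans (sym (unitIndex-inj _ _ e)) (flip-minus b a)) (proj₂ p′) (proj₂ p) a h)

    module Finite {n} (u : Fin n → Carrier) (u-inj : ∀ i j → u i ≈ u j → i ≡ j)
                  (u-surj : ∀ x → Σ[ i ∈ Fin n ] x ≈ u i) (2≤n : 2 ≤ n) where

      index : Carrier → Fin n
      index x = proj₁ (u-surj x)

      u-index : ∀ x → u (index x) ≈ x
      u-index x = sym (proj₂ (u-surj x))

      index-cong : ∀ {x y} → x ≈ y → index x ≡ index y
      index-cong x≈y = u-inj _ _ (trans (u-index _) (trans x≈y (sym (u-index _))))

      index-inj : ∀ {x y} → index x ≡ index y → x ≈ y
      index-inj {x} {y} e = trans (sym (u-index x)) (trans (reflexive (≡.cong u e)) (u-index y))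

      _≈?_ : ∀ x y → Dec (x ≈ y)
      x ≈? y = Dec.map′ index-inj index-cong (index x Fin.≟ index y)

      1≉0 : ¬ (1# ≈ 0#)
      1≉0 1≈0 with Fin.pigeonhole 2≤n (λ _ → zero {0})
      ... | i , j , i<j , _ = Fin.<⇒≢ i<j (u-inj i j (begin
        u i       ≈⟨ *-identityʳ (u i) ⟨
        u i * 1#  ≈⟨ *-congˡ 1≈0 ⟩
        u i * 0#  ≈⟨ zeroʳ (u i) ⟩
        0#        ≈⟨ zeroʳ (u j) ⟨
        u j * 0#  ≈⟨ *-congˡ 1≈0 ⟨
        u j * 1#  ≈⟨ *-identityʳ (u j) ⟩
        u j       ∎))

      Unit-nonzero : ∀ {x} → Unit x → ¬ (x ≈ 0#)
      Unit-nonzero (y , xy) x≈0 = 1≉0 (trans (sym xy) (trans (*-congʳ x≈0) (zeroˡ y)))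

      Adjacent-irrefl : ∀ {a b} → Adjacent a b → ¬ (a ≈ b)
      Adjacent-irrefl {a} {b} p a≈b = Unit-nonzero p (trans (+-congʳ a≈b) (-‿inverseʳ b))

      neighbour : ∀ a s → Adjacent a (a - w s)
      neighbour a s = Unit-resp (solve 2 (λ a x → x := a :- (a :- x)) refl a (w s)) (w-unit s)

      module Lower {k} (colouring : EdgeColouring k) where

        private
          col = proj₁ colouring
          proper = proj₂ (proj₂ (proj₂ colouring))

        unique : ∀ a {b b′} p p′ → col a b p ≡ col a b′ p′ → b ≈ b′
        unique a p p′ e = decidable-stable (_ ≈? _) λ b≉b′ → proper a _ _ p p′ b≉b′ e

        at-vertex : Carrier → Fin φ → Fin k
        at-vertex a s = col a (a - w s) (neighbour a s)

        at-vertex-inj : ∀ a {s t} → at-vertex a s ≡ at-vertex a t → s ≡ t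
        at-vertex-inj a e = w-inj _ _ (minus-cancelˡ (unique a _ _ e))

        φ≤k : φ ≤ k
        φ≤k = Fin.injective⇒≤ (at-vertex-inj 0#)

      -- The edges of one colour form a perfect matching.
      colour-class-even : EdgeColouring φ → ∃ λ m → n ≡ 2 ℕ.* m
      colour-class-even colouring@(col , respects , symmetric , proper) = no-fixed⇒even σ σσ no-fixed
        where
        open Lower colouring
        open Involution using (no-fixed⇒even)
        -- Any colour would do; the unit 1 shows that there is one.
        colour : Fin φ
        colour = unitIndex 1# (1# , *-identityʳ 1#)
        -- The chosen colour and the colours of the φ edges at a are φ + 1 values in `Fin φ`; edges
        -- at a do not clash with each other, so one of them clashes with the chosen colour.
        with-colour : ∀ a → Σ[ s ∈ Fin φ ] at-vertex a s ≡ colour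
        with-colour a with Fin.pigeonhole (ℕ.n<1+n φ) (λ { zero → colour ; (suc s) → at-vertex a s })
        ... | zero , suc s , _ , e = s , ≡.sym e
        ... | suc s , suc t , s<t , e = ⊥-elim (Fin.<⇒≢ s<t (≡.cong suc (at-vertex-inj a e)))
        mate : Carrier → Carrier
        mate a = a - w (proj₁ (with-colour a))
        edge : ∀ a → Adjacent a (mate a)
        edge a = neighbour a (proj₁ (with-colour a))
        -- The neighbour was found from a representative of the vertex; properness makes it
        -- independent of that choice.
        mate-cong : ∀ {a b} → a ≈ b → mate a ≈ mate b
        mate-cong {a} {b} a≈b = unique a (edge a) edge′ (≡.trans (proj₂ (with-colour a))
            (≡.sym (≡.trans (respects a b (mate b) (mate b) edge′ (edge b) a≈b refl) (proj₂ (with-colour b)))))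
          where
          edge′ : Adjacent a (mate b)
          edge′ = Unit-resp (+-congʳ (sym a≈b)) (edge b)
        mate-mate : ∀ a → mate (mate a) ≈ a
        mate-mate a = unique (mate a) (edge (mate a)) (Unit-flip (edge a))
          (≡.trans (proj₂ (with-colour (mate a)))
            (≡.sym (≡.trans (symmetric (mate a) a (Unit-flip (edge a)) (edge a)) (proj₂ (with-colour a)))))
        σ : Fin n → Fin n
        σ i = index (mate (u i))
        σσ : ∀ i → σ (σ i) ≡ i
        σσ i = u-inj _ _ (trans (u-index _) (trans (mate-cong (u-index _)) (mate-mate (u i))))
        no-fixed : ∀ i → σ i ≢ i
        no-fixed i e = Adjacent-irrefl (edge (u i)) (trans (reflexive (≡.cong u (≡.sym e))) (u-index (mate (u i))))

      two-unit⇒odd : Unit (1# + 1#) → ∃ λ m → n ≡ suc (2 ℕ.* m)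
      two-unit⇒odd (h , 2h) = one-fixed⇒odd σ σσ (index 0#)
          (u-inj _ _ (trans (u-index _) (trans (-‿cong (u-index 0#)) (trans (solve 0 (:- con (+ 0) := con (+ 0)) refl) (sym (u-index 0#))))))
          (λ i e → ≡.trans (u-inj i (index (u i)) (sym (u-index (u i)))) (index-cong (fixed⇒0 (u i) (trans (reflexive (≡.cong u (≡.sym e))) (u-index _)))))
        where
        σ : Fin n → Fin n
        σ i = index (- u i)
        σσ : ∀ i → σ (σ i) ≡ i
        σσ i = u-inj _ _ (trans (u-index _) (trans (-‿cong (u-index _)) (solve 1 (λ x → :- (:- x) := x) refl (u i))))
        fixed⇒0 : ∀ x → x ≈ - x → x ≈ 0#
        fixed⇒0 x x≈-x = begin
          x                  ≈⟨ *-identityʳ x ⟨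
          x * 1#             ≈⟨ *-congˡ 2h ⟨
          x * ((1# + 1#) * h) ≈⟨ solve 2 (λ x h → x :* ((con (+ 1) :+ con (+ 1)) :* h) := (x :+ x) :* h) refl x h ⟩
          (x + x) * h        ≈⟨ *-congʳ (+-congˡ x≈-x) ⟩
          (x - x) * h        ≈⟨ solve 2 (λ x h → (x :- x) :* h := con (+ 0)) refl x h ⟩
          0#                 ∎

      not-class-one : Unit (1# + 1#) → ¬ EdgeColouring φ
      not-class-one 2-unit colouring = contradiction (colour-class-even colouring) (two-unit⇒odd 2-unit)
        where
        contradiction : (∃ λ m → n ≡ 2 ℕ.* m) → (∃ λ m → n ≡ suc (2 ℕ.* m)) → ⊥
        contradiction (m , even) (m′ , odd) = ℕ.even≢odd m m′ (≡.trans (≡.sym even) odd)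

      module _ (dec : (P : Set) → Dec P) (Unit? : ∀ x → Dec (Unit x)) where

        E : Fin n → Fin n → Set (c ⊔ ℓ)
        E i j = Adjacent (u i) (u j)

        open Vizing {n = n} {k = suc φ} E Unit-flip (λ p → Adjacent-irrefl p refl)
        open Colouring

        -- If all φ + 1 colours were present at v, the differences to the neighbours along them
        -- would be φ + 1 distinct units.
        missing : ∀ M v → ∃ λ s → mate M s v ≡ v
        missing M v with Fin.any? (λ s → mate M s v Fin.≟ v)
        ... | yes found = found
        ... | no none = ⊥-elim (ℕ.1+n≰n (Fin.injective⇒≤ {f = direction} direction-inj))
          where
          adjacent : ∀ s → E v (mate M s v)
          adjacent s = sound M s v (λ e → none (s , e))
          direction : Fin (suc φ) → Fin φ
          direction s = unitIndex _ (adjacent s)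
          direction-inj : ∀ {s t} → direction s ≡ direction t → s ≡ t
          direction-inj {s} {t} e = uniq M s t v (λ e → none (s , e))
            (u-inj _ _ (minus-cancelˡ (unitIndex-inj (adjacent s) (adjacent t) e)))

        -- The colour found may depend on the adjacency proof; since an edge carries at most one
        -- colour, `colour-unique` removes that dependence.
        vizing-colouring : EdgeColouring (suc φ)
        vizing-colouring with vizing (λ i j → Unit? (u i - u j)) dec missing
        ... | M , all = col , respects , symmetric , proper
          where
          edge : ∀ {a b} → Adjacent a b → E (index a) (index b)
          edge p = Unit-resp (+-cong (sym (u-index _)) (-‿cong (sym (u-index _)))) p
          col : ∀ a b → Adjacent a b → Fin (suc φ)
          col a b p = proj₁ (all (edge p))
          joins : ∀ {a b} p → mate M (col a b p) (index a) ≡ index b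
          joins p = proj₂ (all (edge p))
          colour-unique : ∀ {i j} → E i j → ∀ {s t} → mate M s i ≡ j → mate M t i ≡ j → s ≡ t
          colour-unique {i} Eij {s} {t} es et = uniq M s t i
            (λ fixed → Adjacent-irrefl Eij (reflexive (≡.cong u (≡.trans (≡.sym fixed) es)))) (≡.trans es (≡.sym et))
          respects : ∀ a a′ b b′ p p′ → a ≈ a′ → b ≈ b′ → col a b p ≡ col a′ b′ p′
          respects a a′ b b′ p p′ a≈ b≈ = colour-unique (edge p) (joins p)
            (≡.trans (≡.cong (mate M (col a′ b′ p′)) (index-cong a≈)) (≡.trans (joins p′) (≡.sym (index-cong b≈))))
          symmetric : ∀ a b p q → col a b p ≡ col b a q
          symmetric a b p q = colour-unique (edge p) (joins p)
            (≡.trans (≡.cong (mate M (col b a q)) (≡.sym (joins q))) (invol M (col b a q) (index b)))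
          proper : ∀ a b b′ p p′ → ¬ (b ≈ b′) → col a b p ≢ col a b′ p′
          proper a b b′ p p′ b≉b′ e = b≉b′ (index-inj (≡.trans (≡.sym (joins p))
            (≡.trans (≡.cong (λ s → mate M s (index a)) e) (joins p′))))

-- Assembly of the two cases for R/I.

module Quotient {c ℓ : Level} (R : CommutativeRing c ℓ) (dedekind : IsDedekindDomain R)
  (I : Ideal R) (I≠0 : NonzeroIdeal R I) {n : ℕ} (card : QuotientCard R I n) (2≤n : 2 ≤ n)
  {φ : ℕ} (units : UnitCount R I φ) where
  open CommutativeRing R hiding (zero)
  open IntegerSolver R
  open IdealTheory R
  open ResidueRing R

  dec : (A : Set (c ⊔ ℓ)) → Dec A
  dec = noetherian⇒dec (proj₁ (proj₁ dedekind)) (proj₁ (proj₂ dedekind))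

  u : Fin n → Carrier
  u = proj₁ card

  u-surj : ∀ x → Σ[ i ∈ Fin n ] _≡[_]_ R x I (u i)
  u-surj x = proj₂ (proj₂ (proj₂ card)) x _

  module Graph = Cayley (quotient I)
  module Units = Graph.UnitSystem (proj₁ units) (proj₁ (proj₂ units))
    (proj₁ (proj₂ (proj₂ units))) (proj₂ (proj₂ (proj₂ units)))
  module Vertices = Units.Finite u (proj₁ (proj₂ (proj₂ card))) u-surj 2≤n

  ∣ᴵ⇒⊆ : ∀ P → _∣ᴵ_ R P I → _⊆_ R I P
  ∣ᴵ⇒⊆ P (J , I=PJ) x x∈I with proj₁ (I=PJ x) x∈I
  ... | ps , ps∈ , x≈ = resp P (sym x≈) (sumProd∈ ps ps∈)
    where
    sumProd∈ : ∀ ps → All (λ pr → _∈_ R (proj₁ pr) P × _∈_ R (proj₂ pr) J) ps → _∈_ R (sumProd R ps) P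
    sumProd∈ [] [] = zero∈ P
    sumProd∈ ((p , q) ∷ ps) ((p∈P , _) ∷ ps∈) =
      +-closed P (resp P (*-comm q p) (*-closed P q p∈P)) (sumProd∈ ps ps∈)

  class-one : HasPow2PrimeDivisor R I → EdgeColourable R I φ
  class-one (P , prime , P∣I , e , cardP) = colouring-by (index-two u (λ x → proj₁ (u-surj x) , I⊆P _ (proj₂ (u-surj x))) (proj₁ prime))
    where
    I⊆P : _⊆_ R I P
    I⊆P = ∣ᴵ⇒⊆ P P∣I
    open Elementary dec P (pow2-card⇒two∈ P prime e cardP)
    open Subgroup
    colouring-by : (Σ[ H ∈ Subgroup ] ¬ mem H 1# × (∀ x → mem H x ⊎ mem H (1# - x))) → EdgeColourable R I φ
    colouring-by (H , 1∉H , H-or) = Units.IndexTwo.colouring (mem H) (dec ∘ mem H)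
      -- `H` contains P and hence `I`, so membership depends only on the class modulo `I`.
      (λ {x} {y} x≡y → mem-mod H (I⊆P (x - y) x≡y)) (mem-+ H) (mem-neg H) 1∉H H-or

  two-nonunit⇒pow2 : ¬ IsUnitMod R I two → HasPow2PrimeDivisor R I
  two-nonunit⇒pow2 two-nonunit = divisor (properMaximal (adjoin I two) proper)
    where
    open Noetherian dec (proj₁ (proj₂ dedekind))
    proper : IsProper R (adjoin I two)
    proper (r , 1-2r∈I) = two-nonunit (r , resp I
      (solve 1 (λ r → :- (con (+ 1) :- r :* (con (+ 1) :+ con (+ 1))) := (con (+ 1) :+ con (+ 1)) :* r :- con (+ 1)) refl r)
      (neg-closed I 1-2r∈I))
    divisor : (Σ[ P ∈ Ideal R ] _⊆_ R (adjoin I two) P × IsProper R P ×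
      (∀ x → ¬ (_∈_ R x P) → Σ[ r ∈ Carrier ] _≡[_]_ R 1# P (r * x))) → HasPow2PrimeDivisor R I
    divisor (P , J⊆P , 1∉P , invertible) = P , prime ,
        -- The given nonzero element of `I` is the denominator of the fractions.
        Divisibility.∣ᴵ-of-⊆ R dec dedekind P prime (I⊆P _ (proj₁ (proj₂ I≠0))) (proj₂ (proj₂ I≠0)) invertible I I⊆P ,
        Elementary.card-pow2 dec P (J⊆P two (∈-adjoin I two)) u (λ x → proj₁ (u-surj x) , I⊆P _ (proj₂ (u-surj x)))
      where
      prime : IsPrime R P
      prime = invertible⇒prime dec P 1∉P invertible
      I⊆P : _⊆_ R I P
      I⊆P x x∈I = J⊆P x (⊆-adjoin I two x x∈I)

  φ≤colours : ∀ m → EdgeColourable R I m → φ ≤ m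
  φ≤colours m colouring = Vertices.Lower.φ≤k colouring

  class-two-lower : ¬ HasPow2PrimeDivisor R I → ∀ m → EdgeColourable R I m → suc φ ≤ m
  -- If m were φ, the colouring would show that 2 is not a unit, and `two-nonunit⇒pow2` would
  -- produce the excluded divisor.
  class-two-lower ¬pow2 m colouring = ℕ.≤∧≢⇒< (φ≤colours m colouring) λ { ≡.refl →
    ¬pow2 (two-nonunit⇒pow2 λ two-unit → Vertices.not-class-one two-unit colouring) }

  -- The predicates on vertices and colours in Vizing's proof live in the lowest universe.
  dec₀ : (A : Set) → Dec A
  dec₀ A = Dec.map′ lower lift (dec (Lift (c ⊔ ℓ) A))

  class-two-upper : EdgeColourable R I (suc φ)
  class-two-upper = Vertices.vizing-colouring dec₀ (dec ∘ IsUnitMod R I)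

theorem4p4 : ∀ {c ℓ : Level} (R : CommutativeRing c ℓ) → IsDedekindDomain R →
    (I : Ideal R) → NonzeroIdeal R I →
    (n : ℕ) → QuotientCard R I n → 2 ≤ n →
    (φ : ℕ) → UnitCount R I φ →
    (HasPow2PrimeDivisor R I → ChromaticIndex R I φ) ×
    (¬ HasPow2PrimeDivisor R I → ChromaticIndex R I (suc φ))
theorem4p4 R dedekind I I≠0 n card 2≤n φ units =
  (λ pow2 → class-one pow2 , φ≤colours) ,
  (λ ¬pow2 → class-two-upper , class-two-lower ¬pow2)
  where open Quotient R dedekind I I≠0 card 2≤n units
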